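{- Let $m\ge1$ and let $R_m=\overline{\mathrm{R}}(\mathfrak{B}_m)$. For all integers $R_m\le t\le n$, $$\overline{\mathrm{M}}(n;\mathfrak{B}_m,\mathfrak{B}_m)\ \ge\ \overline{\mathrm{M}}(t;\mathfrak{B}_m,\mathfrak{B}_m)\,\frac{\binom{n}{2m}}{\binom{t}{2m}}.$$ Moreover, $$\overline{\mathrm{M}}(n;\mathfrak{B}_m,\mathfrak{B}_m)\ \le\ \binom{n}{2m}\frac{(2m-2)!}{2^{2m-2}(m-1)!}.$$ Therefore the sequence $\overline{\mathrm{M}}(n;\mathfrak{B}_m,\mathfrak{B}_m)/\binom{n}{2m}$, $n\ge R_m$, is nondecreasing and converges to a density $\pi(\mathfrak{B}_m)$ satisfying $$\frac{\overline{\mathrm{M}}(R_m;\mathfrak{B}_m,\mathfrak{B}_m)}{\binom{R_m}{2m}}\ \le\ \pi(\mathfrak{B}_m)\ \le\ \frac{(2m-2)!}{2^{2m-2}(m-1)!}.$$ In particular, $\overline{\mathrm{M}}(n;\mathfrak{B}_m,\mathfrak{B}_m)=\Theta(n^{2m})$ as $n\to\infty$ for fixed $m$.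
   Context: An ordered graph is a finite graph with a linear order on its vertex set. $\mathcal{K}_n$ is the complete graph on $[n]=\{1,\ldots,n\}$ with the natural order. An order-preserving copy of an ordered graph $\mathcal{H}$ in $\mathcal{G}$ is an injective map $V(\mathcal{H})\to V(\mathcal{G})$ that preserves the vertex order and maps every edge of $\mathcal{H}$ to an edge of $\mathcal{G}$. For $m\ge1$, $\mathfrak{B}_m$ is the family of all ordered perfect matchings on the vertex set $[2m]$ (with its natural order) that contain the edge $\{1,2m\}$. $\overline{\mathrm{R}}(\mathfrak{B}_m)$ is the least $N$ such that every red--blue edge-coloring of $\mathcal{K}_N$ contains a monochromatic order-preserving copy of some member of $\mathfrak{B}_m$. $\overline{\mathrm{M}}(n;\mathfrak{B}_m,\mathfrak{B}_m)$ denotes the minimum, over all red--blue edge-colorings of $\mathcal{K}_n$, of the total number of monochromatic (red or blue) order-preserving copies of members of $\mathfrak{B}_m$, where copies are counted as pairs consisting of a member of $\mathfrak{B}_m$ and the $2m$-element vertex set on which it is placed. -}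

module Defs where

open import Data.Bool using (Bool; true; false; T)
open import Data.Bool.Properties using (T?)
open import Data.Fin using (Fin; toℕ) renaming (_<_ to _<ᶠ_)
open import Data.Fin.Properties using (all?; any?) renaming (_≟_ to _≟ᶠ_; _<?_ to _<ᶠ?_)
open import Data.Fin.Subset using (Subset; _∈_; inside; outside)
open import Data.Fin.Subset.Properties using (_∈?_)
open import Data.Integer using (+_)
open import Data.List using (List; []; _∷_; [_]; length; filter; cartesianProduct; cartesianProductWith; allFin)
open import Data.List.Extrema.Nat using (argmin; f[argmin]≤f[xs])
open import Data.List.Membership.Propositional using (find; lose) renaming (_∈_ to _∈ˡ_)
open import Data.List.Membership.Propositional.Properties using (∈-cartesianProductWith⁺; ∈-allFin)
import Data.List.Relation.Unary.All as All
open import Data.List.Relation.Unary.Any using (here; there) renaming (any? to anyˡ?)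
open import Data.Nat using (ℕ; zero; suc; _*_; _≤_; _≟_)
open import Data.Nat.Combinatorics using (_C_)
open import Data.Product using (∃; ∃!; ∃-syntax; _×_; _,_)
open import Data.Rational using (ℚ; 0ℚ; _/_; ∣_∣) renaming (_+_ to _+ℚ_; _-_ to _-ℚ_; _*_ to _*ℚ_; _≤_ to _≤ℚ_; _<_ to _<ℚ_)
import Data.Rational.Properties as ℚ
open import Data.Vec using (Vec; []; _∷_; lookup; replicate)
open import Function using (_⇔_; mk⇔; Equivalence)
open import Relation.Binary.PropositionalEquality using (_≡_; refl; sym; cong; subst)
open import Relation.Nullary using (¬_; ¬?; Dec; yes; no; _×-dec_; _→-dec_; map′)
open import Relation.Unary using (Decidable)

dec-∃ : ∀ {A : Set} {P : A → Set} (xs : List A) → (∀ x → x ∈ˡ xs) →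
        Decidable P → Dec (∃ P)
dec-∃ xs complete P? =
  map′ (λ p → let x , _ , px = find p in x , px)
       (λ { (x , px) → lose (complete x) px })
       (anyˡ? P? xs)

-- All vectors with entries from xs, each exactly once if xs is duplicate-free.
allVecs : ∀ {A : Set} → List A → ∀ n → List (Vec A n)
allVecs xs zero    = [ [] ]
allVecs xs (suc n) = cartesianProductWith _∷_ xs (allVecs xs n)

∈-allVecs : ∀ {A : Set} {xs : List A} → (∀ x → x ∈ˡ xs) →
            ∀ {n} (v : Vec A n) → v ∈ˡ allVecs xs n
∈-allVecs complete []      = here refl
∈-allVecs complete (x ∷ v) = ∈-cartesianProductWith⁺ _∷_ (complete x) (∈-allVecs complete v)

Matrix : Set → ℕ → Set
Matrix A n = Vec (Vec A n) n

entry : ∀ {A n} → Matrix A n → Fin n → Fin n → A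
entry M i j = lookup (lookup M i) j

allMatrices : ∀ {A : Set} → List A → ∀ n → List (Matrix A n)
allMatrices xs n = allVecs (allVecs xs n) n

∈-allMatrices : ∀ {A : Set} {xs : List A} → (∀ x → x ∈ˡ xs) →
                ∀ {n} (M : Matrix A n) → M ∈ˡ allMatrices xs n
∈-allMatrices complete = ∈-allVecs (∈-allVecs complete)

-- The vertex set [n] = {1 , … , n} is Fin n with its natural order, so the
-- vertex v is the element of Fin n whose toℕ is v ∸ 1.  A graph is given by
-- its adjacency matrix; the simple graphs are the symmetric matrices with
-- zero diagonal.
AdjacencyMatrix : ℕ → Set
AdjacencyMatrix = Matrix Bool

Adj : ∀ {n} → AdjacencyMatrix n → Fin n → Fin n → Set
Adj H i j = T (entry H i j)

IsGraph : ∀ {n} → AdjacencyMatrix n → Set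
IsGraph H = (∀ i j → Adj H i j → Adj H j i) × (∀ i → ¬ Adj H i i)

IsPerfectMatching : ∀ {n} → AdjacencyMatrix n → Set
IsPerfectMatching H = IsGraph H × (∀ i → ∃! _≡_ (Adj H i))

HasOuterEdge : ∀ {n} → AdjacencyMatrix n → Set
HasOuterEdge {n} H = ∃[ i ] ∃[ j ] (toℕ i ≡ 0 × suc (toℕ j) ≡ n × Adj H i j)

In𝔅 : ∀ m → AdjacencyMatrix (2 * m) → Set
In𝔅 m H = IsPerfectMatching H × HasOuterEdge H

data Color : Set where
  red blue : Color

-- The color of the edge {u , v} with u < v is entry χ u v; the
-- entries on and below the diagonal are never read.
Coloring : ℕ → Set
Coloring = Matrix Color

-- f is an order-preserving copy of H in the graph of the edges of color a.
-- Strict monotonicity of f includes injectivity, and each edge of H is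
-- considered from its smaller endpoint.
IsCopyInColor : ∀ {k n} → AdjacencyMatrix k → Coloring n → Color → Vec (Fin n) k → Set
IsCopyInColor H χ a f =
  (∀ i j → i <ᶠ j → lookup f i <ᶠ lookup f j) ×
  (∀ i j → i <ᶠ j → Adj H i j → entry χ (lookup f i) (lookup f j) ≡ a)

HasImage : ∀ {k n} → Vec (Fin n) k → Subset n → Set
HasImage f S = ∀ v → v ∈ S ⇔ (∃[ i ] lookup f i ≡ v)

IsMonoCopy : ∀ {n} m → Coloring n → AdjacencyMatrix (2 * m) × Subset n → Set
IsMonoCopy m χ (H , S) =
  In𝔅 m H × (∃[ a ] ∃[ f ] (IsCopyInColor H χ a f × HasImage f S))

Adj? : ∀ {n} (H : AdjacencyMatrix n) i j → Dec (Adj H i j)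
Adj? H i j = T? (entry H i j)

In𝔅? : ∀ m → Decidable (In𝔅 m)
In𝔅? m H =
  (((all? λ i → all? λ j → Adj? H i j →-dec Adj? H j i) ×-dec
    (all? λ i → ¬? (Adj? H i i))) ×-dec
   (all? λ i → any? λ j → Adj? H i j ×-dec
     map′ (λ g {y} → g y) (λ g y → g {y}) (all? λ y → Adj? H i y →-dec (j ≟ᶠ y)))) ×-dec
  (any? λ i → any? λ j → (toℕ i ≟ 0) ×-dec (suc (toℕ j) ≟ 2 * m) ×-dec Adj? H i j)

_≟ᶜ_ : (a b : Color) → Dec (a ≡ b)
red  ≟ᶜ red  = yes refl
red  ≟ᶜ blue = no λ ()
blue ≟ᶜ red  = no λ ()
blue ≟ᶜ blue = yes refl

colors : List Color
colors = red ∷ blue ∷ []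

∈-colors : ∀ a → a ∈ˡ colors
∈-colors red  = here refl
∈-colors blue = there (here refl)

IsCopyInColor? : ∀ {k n} (H : AdjacencyMatrix k) (χ : Coloring n) a f →
                 Dec (IsCopyInColor H χ a f)
IsCopyInColor? H χ a f =
  (all? λ i → all? λ j → (i <ᶠ? j) →-dec (lookup f i <ᶠ? lookup f j)) ×-dec
  (all? λ i → all? λ j → (i <ᶠ? j) →-dec (Adj? H i j →-dec
    (entry χ (lookup f i) (lookup f j) ≟ᶜ a)))

HasImage? : ∀ {k n} (f : Vec (Fin n) k) (S : Subset n) → Dec (HasImage f S)
HasImage? f S = all? λ v →
  let v∈f? = any? λ i → lookup f i ≟ᶠ v in
  map′ (λ (p , q) → mk⇔ p q) (λ e → Equivalence.to e , Equivalence.from e)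
       (((v ∈? S) →-dec v∈f?) ×-dec (v∈f? →-dec (v ∈? S)))

IsMonoCopy? : ∀ {n} m (χ : Coloring n) → Decidable (IsMonoCopy m χ)
IsMonoCopy? {n} m χ (H , S) =
  In𝔅? m H ×-dec
  dec-∃ colors ∈-colors λ a →
  dec-∃ (allVecs (allFin n) (2 * m)) (∈-allVecs ∈-allFin) λ f →
  IsCopyInColor? H χ a f ×-dec HasImage? f S

Arrows𝔅 : ℕ → ℕ → Set
Arrows𝔅 m N = (χ : Coloring N) → ∃[ HS ] IsMonoCopy m χ HS

IsRamseyNumber𝔅 : ℕ → ℕ → Set
IsRamseyNumber𝔅 m R = Arrows𝔅 m R × (∀ N → Arrows𝔅 m N → R ≤ N)

-- The enumerations of matrices and of subsets are free of repetitions, so this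
-- is the number of pairs (H , S).
#monoCopies : ∀ {n} → ℕ → Coloring n → ℕ
#monoCopies {n} m χ =
  length (filter (IsMonoCopy? m χ)
    (cartesianProduct (allMatrices (false ∷ true ∷ []) (2 * m))
                      (allVecs (outside ∷ inside ∷ []) n)))

optimalColoring : ∀ m n → Coloring n
optimalColoring m n =
  argmin (#monoCopies m) (replicate n (replicate n red)) (allMatrices colors n)

-- M̄(n; 𝔅ₘ, 𝔅ₘ), attained by construction; see also M̄-minimal.
M̄ : ℕ → ℕ → ℕ
M̄ m n = #monoCopies m (optimalColoring m n)

M̄-minimal : ∀ m {n} (χ : Coloring n) → M̄ m n ≤ #monoCopies m χ
M̄-minimal m {n} χ =
  All.lookup (f[argmin]≤f[xs] (replicate n (replicate n red)) (allMatrices colors n))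
             (∈-allMatrices ∈-colors χ)

toℚ : ℕ → ℚ
toℚ k = + k / 1

-- The quotient k / d, with the convention k / 0 = 0.
_÷_ : ℕ → ℕ → ℚ
k ÷ zero  = 0ℚ
k ÷ suc d = + k / suc d

-- The convention 0 is in force only for n < 2m, hence never for n ≥ R̄(𝔅ₘ).
density : ℕ → ℕ → ℚ
density m n = M̄ m n ÷ (n C (2 * m))

_isΘ_ : (ℕ → ℕ) → (ℕ → ℕ) → Set
f isΘ g = ∃[ c ] ∃[ d ] ∃[ N ] (0ℚ <ℚ c × 0ℚ <ℚ d ×
  (∀ n → N ≤ n → c *ℚ toℚ (g n) ≤ℚ toℚ (f n) × toℚ (f n) ≤ℚ d *ℚ toℚ (g n)))

-- Real numbers are Cauchy sequences of rationals with a modulus.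
record ℝ : Set where
  field
    approx : ℕ → ℚ
    cauchy : ∀ ε → 0ℚ <ℚ ε →
             ∃[ N ] (∀ k l → N ≤ k → N ≤ l → ∣ approx k -ℚ approx l ∣ ≤ℚ ε)

open ℝ public

_≤ℝ_ : ℝ → ℝ → Set
x ≤ℝ y = ∀ ε → 0ℚ <ℚ ε → ∃[ N ] (∀ k → N ≤ k → approx x k ≤ℚ approx y k +ℚ ε)

fromℚ : ℚ → ℝ
fromℚ q = record
  { approx = λ _ → q
  ; cauchy = λ ε 0<ε → 0 , λ _ _ _ _ →
      subst (_≤ℚ ε) (sym (cong ∣_∣ (ℚ.+-inverseʳ q))) (ℚ.<⇒≤ 0<ε)
  }

-- aₙ → x as n → ∞; the inner condition says |aₙ - x| ≤ ε.
_ConvergesTo_ : (ℕ → ℚ) → ℝ → Set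
a ConvergesTo x = ∀ ε → 0ℚ <ℚ ε → ∃[ N ] (∀ n → N ≤ n →
  fromℚ (a n -ℚ ε) ≤ℝ x × x ≤ℝ fromℚ (a n +ℚ ε))

{-# OPTIONS --safe #-}
module Submission where

-- Let k = 2m.  Averaging over the n + 1 ways to delete a vertex from an optimal coloring of K_{n+1}
-- gives (n+1) M̄(n) ≤ (n+1-k) M̄(n+1), so the densities are nondecreasing.  Coloring each edge by a
-- random color attached to its smaller endpoint makes every member of 𝔅ₘ monochromatic with
-- probability 2^(1-m), and ∣𝔅ₘ∣ ≤ (2m-3)!!, which gives the upper bound.
--
-- A bounded monotone sequence need not converge constructively, so an explicit rate is needed.
-- Averaging over the n ways to double a vertex of an optimal coloring of K_n gives
--   n M̄(n+1) ≤ (n+k) M̄(n) + ∣𝔅ₘ∣ (k-1) C(n,k-1),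
-- and hence density(n+1) ≤ density(n) + c/n - c/(n+1) with c = ∣𝔅ₘ∣ (k-1) k.

open import Defs
open import Data.Bool using (true; false; if_then_else_; T)
open import Data.Bool.Properties using () renaming (_≟_ to _≟ᵇ_)
open import Data.Fin using (Fin; zero; suc; toℕ; punchIn; pinch; inject₁; fromℕ; punchOut) renaming (_<_ to _<ᶠ_; _≤_ to _≤ᶠ_)
open import Data.Fin.Properties using (any?; all?; toℕ-injective; pinch-mono-≤; punchIn-mono-≤; punchIn-cancel-≤; punchIn-injective; punchInᵢ≢i; punchIn-punchOut; pinch-injective; toℕ-inject₁; toℕ-fromℕ) renaming (_≟_ to _≟ᶠ_; _<?_ to _<ᶠ?_; <-cmp to <ᶠ-cmp; suc-injective to suc-injectiveᶠ)
open import Data.Fin.Subset using (Subset; inside; outside; ∣_∣; _∈_; _∉_)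
open import Data.Fin.Subset.Properties using (∣p∣≤n; _∈?_)
import Data.Integer as ℤ
import Data.Integer.Properties as ℤ
open import Data.List using (List; []; _∷_; _++_; length; map; filter; cartesianProduct; cartesianProductWith; allFin)
open import Data.List.Membership.Propositional using () renaming (_∈_ to _∈ˡ_)
open import Data.List.Membership.Propositional.Properties using (∈-allFin; ∈-cartesianProduct⁺)
open import Data.List.Properties using (map-tabulate; map-++; map-∘; length-tabulate)
import Data.List.Relation.Unary.All as All
open import Data.List.Relation.Unary.AllPairs using ([]; _∷_)
open import Data.List.Relation.Unary.Any using (here; there)
open import Data.List.Relation.Unary.Unique.Propositional using (Unique)
open import Data.List.Relation.Unary.Unique.Propositional.Properties using (cartesianProductWith⁺; allFin⁺)
open import Data.Nat using (ℕ; zero; suc; _+_; _*_; _∸_; _^_; _≤_; _<_; z≤n; s≤s; _≟_; _≤′_; ≤′-refl; ≤′-step; _⊔_)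
open import Data.Nat.Base using (_!)
open import Data.Nat.Combinatorics using (_C_; nCk+nC[k+1]≡[n+1]C[k+1]; k>n⇒nCk≡0)
open import Data.Nat.ListAction using (sum)
open import Data.Nat.ListAction.Properties using (sum-++)
open import Data.Nat.Properties hiding (_≟_)
open import Data.Nat.Tactic.RingSolver using (solve-∀)
open import Data.Product using (∃; ∃-syntax; _×_; _,_; proj₁; proj₂; ∃!)
open import Data.Rational using (ℚ; 0ℚ; mkℚ; toℚᵘ) renaming (_+_ to _+ℚ_; _-_ to _-ℚ_; _*_ to _*ℚ_; _≤_ to _≤ℚ_; _<_ to _<ℚ_; -_ to -ℚ_; ∣_∣ to ∣_∣ℚ)
import Data.Rational.Properties as ℚ
open import Data.Rational.Unnormalised using (mkℚᵘ; *≤*; *≡*) renaming (_+_ to _+ᵘ_; _*_ to _*ᵘ_; _≃_ to _≃ᵘ_)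
import Data.Rational.Unnormalised.Properties as ℚᵘ
open import Data.Sum using (_⊎_; inj₁; inj₂; [_,_]′)
open import Data.Unit using (tt)
open import Data.Vec using (Vec; []; _∷_; lookup; insertAt; _[_]≔_; tabulate; replicate; here; there)
open import Data.Vec.Properties using (insertAt-lookup; ∷-injective; insertAt-punchIn; lookup∘tabulate; tabulate∘lookup; tabulate-cong; []=⇒lookup; lookup⇒[]=; lookup∘update; lookup∘update′; ≡-dec; lookup-replicate)
open import Function using (_∘_; id; mk⇔; Equivalence)
open import Relation.Binary.Definitions using (tri<; tri≈; tri>)
open import Relation.Binary.PropositionalEquality using (_≡_; refl; sym; trans; cong; cong₂; subst; module ≡-Reasoning; _≢_; subst₂)
open import Relation.Nullary using (¬_; Dec; yes; no; contradiction; _×-dec_; _→-dec_; does; ¬?; map′)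
open import Relation.Nullary.Decidable using (dec-true)
open import Relation.Unary using (Decidable)
open import Algebra.Properties.CommutativeSemigroup *-commutativeSemigroup using (x∙yz≈y∙xz; x∙yz≈yx∙z; x∙yz≈xz∙y; x∙yz≈y∙zx)
open import Algebra.Properties.Group ℚ.+-0-group using (⁻¹-anti-homo-//)

-- With k = 2m, dividing the doubling inequality by n C(n+1,k) turns the factor of M̄(n) into
-- (n+k)(n+1-k)/(n(n+1)) = 1 - k(k-1)/(n(n+1)) relative to the density, which is at most 1. The
-- error becomes ∣𝔅ₘ∣(k-1)k/(n(n+1)), and this telescopes; hence the value of c. The error comes
-- from the copies through both twins. The edge between the twins receives a diagonal entry of the
-- coloring, which is arbitrary, so nothing better than the trivial bound ∣𝔅ₘ∣ per vertex set is
-- attempted there. Such sets are scarce enough for the loss to be summable. The constant of the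
-- upper bound is 2^(1-m) (2m-3)!! with (2m-3)!! = (2m-2)!/(2^(m-1) (m-1)!). All counting is done in
-- ℕ with denominators cleared and with subtracted terms moved to the other side. Rationals enter
-- only to chain the resulting inequalities and to state the limit.

private variable
  A B X : Set
  k l n : ℕ

-- Finite sums and double counting

∑ : List A → (A → ℕ) → ℕ
∑ xs f = sum (map f xs)

∑-cong : ∀ (xs : List A) {f g : A → ℕ} → (∀ x → f x ≡ g x) → ∑ xs f ≡ ∑ xs g
∑-cong []       f≗g = refl
∑-cong (x ∷ xs) f≗g = cong₂ _+_ (f≗g x) (∑-cong xs f≗g)

∑-mono : ∀ (xs : List A) {f g : A → ℕ} → (∀ x → f x ≤ g x) → ∑ xs f ≤ ∑ xs g
∑-mono []       f≤g = z≤n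
∑-mono (x ∷ xs) f≤g = +-mono-≤ (f≤g x) (∑-mono xs f≤g)

∑-+ : ∀ (xs : List A) (f g : A → ℕ) → ∑ xs (λ x → f x + g x) ≡ ∑ xs f + ∑ xs g
∑-+ []       f g = refl
∑-+ (x ∷ xs) f g = trans (cong (f x + g x +_) (∑-+ xs f g)) (interchange (f x) (g x) (∑ xs f) (∑ xs g))
  where
  interchange : ∀ a b c d → a + b + (c + d) ≡ a + c + (b + d)
  interchange = solve-∀

∑-*ˡ : ∀ (xs : List A) c (f : A → ℕ) → ∑ xs (λ x → c * f x) ≡ c * ∑ xs f
∑-*ˡ []       c f = sym (*-zeroʳ c)
∑-*ˡ (x ∷ xs) c f = trans (cong (c * f x +_) (∑-*ˡ xs c f)) (sym (*-distribˡ-+ c (f x) (∑ xs f)))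

∑-const : ∀ (xs : List A) c → ∑ xs (λ _ → c) ≡ length xs * c
∑-const []       c = refl
∑-const (x ∷ xs) c = cong (c +_) (∑-const xs c)

∑-0 : ∀ (xs : List A) → ∑ xs (λ _ → 0) ≡ 0
∑-0 xs = trans (∑-const xs 0) (*-zeroʳ (length xs))

∑-1 : ∀ (xs : List A) → ∑ xs (λ _ → 1) ≡ length xs
∑-1 xs = trans (∑-const xs 1) (*-identityʳ (length xs))

∑-swap : ∀ (xs : List A) (ys : List B) (f : A → B → ℕ) →
         ∑ xs (λ x → ∑ ys (f x)) ≡ ∑ ys (λ y → ∑ xs (λ x → f x y))
∑-swap []       ys f = sym (∑-0 ys)
∑-swap (x ∷ xs) ys f = trans (cong (∑ ys (f x) +_) (∑-swap xs ys f)) (sym (∑-+ ys (f x) _))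

∑-++ : ∀ (xs ys : List A) (f : A → ℕ) → ∑ (xs ++ ys) f ≡ ∑ xs f + ∑ ys f
∑-++ xs ys f = trans (cong sum (map-++ f xs ys)) (sum-++ (map f xs) (map f ys))

∑-map : ∀ (h : A → B) (xs : List A) (f : B → ℕ) → ∑ (map h xs) f ≡ ∑ xs (f ∘ h)
∑-map h xs f = cong sum (sym (map-∘ xs))

∑-cartesianProductWith : ∀ (h : A → B → X) (xs : List A) (ys : List B) (f : X → ℕ) →
  ∑ (cartesianProductWith h xs ys) f ≡ ∑ xs (λ x → ∑ ys (λ y → f (h x y)))
∑-cartesianProductWith h []       ys f = refl
∑-cartesianProductWith h (x ∷ xs) ys f =
  trans (∑-++ (map (h x) ys) (cartesianProductWith h xs ys) f)
        (cong₂ _+_ (∑-map (h x) ys f) (∑-cartesianProductWith h xs ys f))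

∑-allFin-suc : ∀ n (f : Fin (suc n) → ℕ) → ∑ (allFin (suc n)) f ≡ f zero + ∑ (allFin n) (f ∘ suc)
∑-allFin-suc n f = cong (λ l → f zero + sum l) (trans (map-tabulate suc f) (sym (map-tabulate id (f ∘ suc))))

length-allFin : ∀ n → length (allFin n) ≡ n
length-allFin n = length-tabulate id

ind : ∀ {P : Set} → Dec P → ℕ
ind (yes _) = 1
ind (no _)  = 0

ind-mono : ∀ {P Q : Set} (P? : Dec P) (Q? : Dec Q) → (P → Q) → ind P? ≤ ind Q?
ind-mono (no _)  _       _ = z≤n
ind-mono (yes p) (yes _) _ = ≤-refl
ind-mono (yes p) (no ¬q) f = contradiction (f p) ¬q

ind≤1 : ∀ {P : Set} (P? : Dec P) → ind P? ≤ 1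
ind≤1 (no _)  = z≤n
ind≤1 (yes _) = ≤-refl

ind-yes : ∀ {P : Set} (P? : Dec P) → P → ind P? ≡ 1
ind-yes (yes _) _ = refl
ind-yes (no ¬p) p = contradiction p ¬p

ind-no : ∀ {P : Set} (P? : Dec P) → ¬ P → ind P? ≡ 0
ind-no (yes p) ¬p = contradiction p ¬p
ind-no (no _)  _  = refl

count : ∀ {P : A → Set} → Decidable P → List A → ℕ
count P? xs = ∑ xs (λ x → ind (P? x))

-- As a sum of indicators, a cardinality can be double counted by `∑-swap`.
length-filter≡count : ∀ {P : A → Set} (P? : Decidable P) xs → length (filter P? xs) ≡ count P? xs
length-filter≡count P? [] = refl
length-filter≡count P? (x ∷ xs) with P? x
... | yes _ = cong suc (length-filter≡count P? xs)
... | no _  = length-filter≡count P? xs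

count≥1 : ∀ {P : A → Set} (P? : Decidable P) {xs x} → x ∈ˡ xs → P x → 1 ≤ count P? xs
count≥1 P? {xs = x ∷ xs} (here refl) px = m≤n⇒m≤n+o _ (≤-reflexive (sym (ind-yes (P? x) px)))
count≥1 P? {xs = y ∷ xs} (there x∈xs) px = m≤n⇒m≤o+n _ (count≥1 P? x∈xs px)

count≡0 : ∀ {P : A → Set} (P? : Decidable P) xs → (∀ x → ¬ P x) → count P? xs ≡ 0
count≡0 P? xs ¬p = trans (∑-cong xs (λ x → ind-no (P? x) (¬p x))) (∑-0 xs)

count≤1 : ∀ {P : A → Set} (P? : Decidable P) {xs} → Unique xs →
          (∀ x y → P x → P y → x ≡ y) → count P? xs ≤ 1
count≤1 P? [] _ = z≤n
count≤1 {P = P} P? {x ∷ xs} (x∉xs ∷ uniq) irr with P? x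
... | no _   = count≤1 P? uniq irr
... | yes px = s≤s (≤-reflexive (none xs x∉xs))
  where
  none : ∀ ys → All.All (λ y → ¬ x ≡ y) ys → count P? ys ≡ 0
  none [] _ = refl
  none (y ∷ ys) (x≢y All.∷ rest) = cong₂ _+_ (ind-no (P? y) (λ py → x≢y (irr x y px py))) (none ys rest)

count-mono : ∀ {P Q : A → Set} (P? : Decidable P) (Q? : Decidable Q) xs →
             (∀ x → P x → Q x) → count P? xs ≤ count Q? xs
count-mono P? Q? xs P⊆Q = ∑-mono xs (λ x → ind-mono (P? x) (Q? x) (P⊆Q x))

-- Count the pairs related by R first by rows, then by columns.
count-≤ : ∀ {P : A → Set} {Q : B → Set} {R : A → B → Set}
          (P? : Decidable P) (Q? : Decidable Q) (R? : ∀ x y → Dec (R x y)) {xs ys} → Unique xs →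
          (∀ x → P x → ∃[ y ] (y ∈ˡ ys × Q y × R x y)) →
          (∀ x x′ y → P x → P x′ → R x y → R x′ y → x ≡ x′) →
          count P? xs ≤ count Q? ys
count-≤ {A} {B} {P} {Q} {R} P? Q? R? {xs} {ys} uniq total inj = begin
  count P? xs                                         ≤⟨ ∑-mono xs row ⟩
  ∑ xs (λ x → ∑ ys (λ y → ind (W? x y)))              ≡⟨ ∑-swap xs ys _ ⟩
  ∑ ys (λ y → ∑ xs (λ x → ind (W? x y)))              ≤⟨ ∑-mono ys column ⟩
  count Q? ys                                         ∎
  where
  open ≤-Reasoning
  W? : ∀ x y → Dec (P x × Q y × R x y)
  W? x y = P? x ×-dec Q? y ×-dec R? x y
  row : ∀ x → ind (P? x) ≤ count (W? x) ys
  row x with P? x in eq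
  ... | no _   = z≤n
  ... | yes px with y , y∈ys , qy , rxy ← total x px
               = subst (1 ≤_) (∑-cong ys (λ y → cong (λ d → ind (d ×-dec Q? y ×-dec R? x y)) eq)) (count≥1 (W? x) y∈ys (px , qy , rxy))
  column : ∀ y → count (λ x → W? x y) xs ≤ ind (Q? y)
  column y with Q? y
  ... | yes qy = count≤1 (λ x → P? x ×-dec yes qy ×-dec R? x y) uniq (λ x x′ (px , _ , r) (px′ , _ , r′) → inj x x′ y px px′ r r′)
  ... | no ¬qy = ≤-reflexive (count≡0 (λ x → P? x ×-dec no ¬qy ×-dec R? x y) xs (λ _ (_ , qy , _) → ¬qy qy))

-- Enumerations of vectors

allVecs-unique : ∀ {xs : List A} → Unique xs → ∀ n → Unique (allVecs xs n)
allVecs-unique uniq zero    = All.[] ∷ []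
allVecs-unique uniq (suc n) = cartesianProductWith⁺ _∷_ ∷-injective uniq (allVecs-unique uniq n)

∑-allVecs-suc : ∀ (xs : List A) n (f : Vec A (suc n) → ℕ) →
  ∑ (allVecs xs (suc n)) f ≡ ∑ xs (λ x → ∑ (allVecs xs n) (λ v → f (x ∷ v)))
∑-allVecs-suc xs n f = ∑-cartesianProductWith _∷_ xs (allVecs xs n) f

-- Any coordinate may be summed outermost; the induction exchanges it with the one in front of it.
-- For subsets this splits a sum by membership of an arbitrary vertex.
∑-insertAt : ∀ (xs : List A) n (i : Fin (suc n)) (f : Vec A (suc n) → ℕ) →
  ∑ (allVecs xs (suc n)) f ≡ ∑ xs (λ x → ∑ (allVecs xs n) (λ v → f (insertAt v i x)))
∑-insertAt xs n zero f = ∑-allVecs-suc xs n f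
∑-insertAt xs (suc n) (suc i) f = begin
  ∑ (allVecs xs (suc (suc n))) f
    ≡⟨ ∑-allVecs-suc xs (suc n) f ⟩
  ∑ xs (λ y → ∑ (allVecs xs (suc n)) (λ v → f (y ∷ v)))
    ≡⟨ ∑-cong xs (λ y → ∑-insertAt xs n i (f ∘ (y ∷_))) ⟩
  ∑ xs (λ y → ∑ xs (λ x → ∑ (allVecs xs n) (λ v → f (y ∷ insertAt v i x))))
    ≡⟨ ∑-swap xs xs _ ⟩
  ∑ xs (λ x → ∑ xs (λ y → ∑ (allVecs xs n) (λ v → f (y ∷ insertAt v i x))))
    ≡⟨ ∑-cong xs (λ x → ∑-allVecs-suc xs n (λ v → f (insertAt v (suc i) x))) ⟨
  ∑ xs (λ x → ∑ (allVecs xs (suc n)) (λ v → f (insertAt v (suc i) x))) ∎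
  where open ≡-Reasoning

-- Sums over subsets

subsets : ∀ n → List (Subset n)
subsets = allVecs (outside ∷ inside ∷ [])

-- Sets avoiding v get weight zero instead of being removed from the list, so that a further sum
-- over v can be exchanged with this one.
_∑∋_ : ∀ {n} → Fin n → (Subset n → ℕ) → ℕ
v ∑∋ f = ∑ (subsets _) (λ S → if lookup S v then f S else 0)

∑-subsets-suc : ∀ n (f : Subset (suc n) → ℕ) →
  ∑ (subsets (suc n)) f ≡ ∑ (subsets n) (f ∘ (outside ∷_)) + ∑ (subsets n) (f ∘ (inside ∷_))
∑-subsets-suc n f = trans (∑-allVecs-suc _ n f) (cong (∑ (subsets n) (f ∘ (outside ∷_)) +_) (+-identityʳ _))

∑-subsets-insertAt : ∀ {n} (v : Fin (suc n)) (f : Subset (suc n) → ℕ) →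
  ∑ (subsets (suc n)) f ≡ ∑ (subsets n) (λ S → f (insertAt S v outside)) + ∑ (subsets n) (λ S → f (insertAt S v inside))
∑-subsets-insertAt {n} v f =
  trans (∑-insertAt _ n v f) (cong (∑ (subsets n) (λ S → f (insertAt S v outside)) +_) (+-identityʳ _))

∑∋-insertAt : ∀ {n} (v : Fin (suc n)) (f : Subset (suc n) → ℕ) →
  v ∑∋ f ≡ ∑ (subsets n) (λ S → f (insertAt S v inside))
∑∋-insertAt {n} v f = trans (∑-subsets-insertAt v _)
  (cong₂ _+_ (trans (∑-cong (subsets n) (λ S → cong (if_then f (insertAt S v outside) else 0) (insertAt-lookup S v outside))) (∑-0 (subsets n)))
             (∑-cong (subsets n) (λ S → cong (if_then f (insertAt S v inside) else 0) (insertAt-lookup S v inside))))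

-- Adding v is a bijection from the sets without v to the sets with v.
∑∋-update : ∀ {n} (v : Fin n) (f : Subset n → ℕ) →
  ∑ (subsets n) (λ S → if lookup S v then 0 else f (S [ v ]≔ inside)) ≡ v ∑∋ f
∑∋-update {suc n} zero f = begin
  ∑ (subsets (suc n)) (λ S → if lookup S zero then 0 else f (S [ zero ]≔ inside))
    ≡⟨ ∑-subsets-suc n _ ⟩
  ∑ (subsets n) (f ∘ (inside ∷_)) + ∑ (subsets n) (λ _ → 0)
    ≡⟨ +-comm (∑ (subsets n) (f ∘ (inside ∷_))) _ ⟩
  ∑ (subsets n) (λ _ → 0) + ∑ (subsets n) (f ∘ (inside ∷_))
    ≡⟨ ∑-subsets-suc n _ ⟨
  zero ∑∋ f ∎
  where open ≡-Reasoning
∑∋-update {suc n} (suc v) f =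
  trans (∑-subsets-suc n _)
 (trans (cong₂ _+_ (∑∋-update v (f ∘ (outside ∷_))) (∑∋-update v (f ∘ (inside ∷_))))
        (sym (∑-subsets-suc n (λ S → if lookup S (suc v) then f S else 0))))

∑-lookup : ∀ {n} (S : Subset n) c → ∑ (allFin n) (λ v → if lookup S v then c else 0) ≡ ∣ S ∣ * c
∑-lookup [] c = refl
∑-lookup {suc n} (outside ∷ S) c = trans (∑-allFin-suc n (λ v → if lookup (outside ∷ S) v then c else 0)) (∑-lookup S c)
∑-lookup {suc n} (inside ∷ S)  c = trans (∑-allFin-suc n (λ v → if lookup (inside ∷ S) v then c else 0)) (cong (c +_) (∑-lookup S c))

-- Double counting of the incidences between vertices and sets.
∑∋-total : ∀ {n} (f : Subset n → ℕ) → ∑ (allFin n) (_∑∋ f) ≡ ∑ (subsets n) (λ S → ∣ S ∣ * f S)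
∑∋-total {n} f = trans (∑-swap (allFin n) (subsets n) _) (∑-cong (subsets n) (λ S → ∑-lookup S (f S)))

#subsets-ofSize : ∀ n k → count (λ S → ∣ S ∣ ≟ k) (subsets n) ≡ n C k
#subsets-ofSize zero zero = refl
#subsets-ofSize zero (suc k) = refl
#subsets-ofSize (suc n) zero = trans (∑-subsets-suc n _) (trans (cong₂ _+_ (#subsets-ofSize n zero) (∑-0 (subsets n))) refl)
#subsets-ofSize (suc n) (suc k) = begin
  count (λ S → ∣ S ∣ ≟ suc k) (subsets (suc n))
    ≡⟨ ∑-subsets-suc n _ ⟩
  count (λ S → ∣ S ∣ ≟ suc k) (subsets n) + ∑ (subsets n) (λ S → ind (suc ∣ S ∣ ≟ suc k))
    ≡⟨ cong₂ _+_ (#subsets-ofSize n (suc k)) (trans (∑-cong (subsets n) shift) (#subsets-ofSize n k)) ⟩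
  n C suc k + n C k
    ≡⟨ +-comm (n C suc k) (n C k) ⟩
  n C k + n C suc k
    ≡⟨ nCk+nC[k+1]≡[n+1]C[k+1] n k ⟩
  suc n C suc k ∎
  where
  open ≡-Reasoning
  shift : ∀ S → ind (suc ∣ S ∣ ≟ suc k) ≡ ind (∣ S ∣ ≟ k)
  shift S = ≤-antisym (ind-mono (suc ∣ S ∣ ≟ suc k) (∣ S ∣ ≟ k) suc-injective) (ind-mono (∣ S ∣ ≟ k) (suc ∣ S ∣ ≟ suc k) (cong suc))

-- Binomial coefficients

-- The absorption identity, derived from Pascal's rule without division.
[k+1]*[n+1]C[k+1]≡[n+1]*nCk : ∀ n k → suc k * (suc n C suc k) ≡ suc n * (n C k)
[k+1]*[n+1]C[k+1]≡[n+1]*nCk zero zero = refl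
[k+1]*[n+1]C[k+1]≡[n+1]*nCk zero (suc k) =
  trans (cong (suc (suc k) *_) (k>n⇒nCk≡0 {1} {suc (suc k)} (s≤s (s≤s z≤n)))) (*-zeroʳ (suc (suc k)))
[k+1]*[n+1]C[k+1]≡[n+1]*nCk (suc n) zero = begin
  1 * (suc (suc n) C 1)             ≡⟨ cong (1 *_) (nCk+nC[k+1]≡[n+1]C[k+1] (suc n) 0) ⟨
  1 * (1 + (suc n C 1))             ≡⟨ *-distribˡ-+ 1 1 (suc n C 1) ⟩
  1 + 1 * (suc n C 1)               ≡⟨ cong (1 +_) ([k+1]*[n+1]C[k+1]≡[n+1]*nCk n 0) ⟩
  suc (suc n) * 1 ∎
  where open ≡-Reasoning
[k+1]*[n+1]C[k+1]≡[n+1]*nCk (suc n) (suc k) = begin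
  suc (suc k) * (suc (suc n) C suc (suc k))
    ≡⟨ cong (suc (suc k) *_) (nCk+nC[k+1]≡[n+1]C[k+1] (suc n) (suc k)) ⟨
  suc (suc k) * (C₁ + (suc n C suc (suc k)))
    ≡⟨ *-distribˡ-+ (suc (suc k)) C₁ (suc n C suc (suc k)) ⟩
  C₁ + suc k * C₁ + suc (suc k) * (suc n C suc (suc k))
    ≡⟨ cong₂ (λ x y → C₁ + x + y) ([k+1]*[n+1]C[k+1]≡[n+1]*nCk n k) ([k+1]*[n+1]C[k+1]≡[n+1]*nCk n (suc k)) ⟩
  C₁ + suc n * (n C k) + suc n * (n C suc k)
    ≡⟨ +-assoc C₁ (suc n * (n C k)) (suc n * (n C suc k)) ⟩
  C₁ + (suc n * (n C k) + suc n * (n C suc k))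
    ≡⟨ cong (C₁ +_) (*-distribˡ-+ (suc n) (n C k) (n C suc k)) ⟨
  C₁ + suc n * (n C k + n C suc k)
    ≡⟨ cong (λ x → C₁ + suc n * x) (nCk+nC[k+1]≡[n+1]C[k+1] n k) ⟩
  suc (suc n) * C₁ ∎
  where
  open ≡-Reasoning
  C₁ = suc n C suc k

-- A subtraction-free form of (n+1) C(n,k) = (n+1-k) C(n+1,k).
[n+1]*nCk+k*[n+1]Ck≡[n+1]*[n+1]Ck : ∀ n k → suc n * (n C k) + k * (suc n C k) ≡ suc n * (suc n C k)
[n+1]*nCk+k*[n+1]Ck≡[n+1]*[n+1]Ck n zero = +-identityʳ _
[n+1]*nCk+k*[n+1]Ck≡[n+1]*[n+1]Ck n (suc k) = begin
  suc n * (n C suc k) + suc k * (suc n C suc k)   ≡⟨ cong (suc n * (n C suc k) +_) ([k+1]*[n+1]C[k+1]≡[n+1]*nCk n k) ⟩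
  suc n * (n C suc k) + suc n * (n C k)           ≡⟨ +-comm (suc n * (n C suc k)) _ ⟩
  suc n * (n C k) + suc n * (n C suc k)           ≡⟨ *-distribˡ-+ (suc n) (n C k) (n C suc k) ⟨
  suc n * (n C k + n C suc k)                     ≡⟨ cong (suc n *_) (nCk+nC[k+1]≡[n+1]C[k+1] n k) ⟩
  suc n * (suc n C suc k) ∎
  where open ≡-Reasoning

-- The right side is the product (a+1)(a+2)...(a+k), whose factors all exceed a.
a^k≤k!*[a+k]Ck : ∀ a k → a ^ k ≤ k ! * ((a + k) C k)
a^k≤k!*[a+k]Ck a zero = ≤-refl
a^k≤k!*[a+k]Ck a (suc k) = begin
  a * a ^ k                                  ≤⟨ *-mono-≤ (m≤n⇒m≤1+n (m≤m+n a k)) (a^k≤k!*[a+k]Ck a k) ⟩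
  suc (a + k) * (k ! * ((a + k) C k))        ≡⟨ x∙yz≈y∙xz (suc (a + k)) (k !) ((a + k) C k) ⟩
  k ! * (suc (a + k) * ((a + k) C k))        ≡⟨ cong (k ! *_) ([k+1]*[n+1]C[k+1]≡[n+1]*nCk (a + k) k) ⟨
  k ! * (suc k * (suc (a + k) C suc k))      ≡⟨ x∙yz≈yx∙z (k !) (suc k) (suc (a + k) C suc k) ⟩
  suc k * k ! * (suc (a + k) C suc k)        ≡⟨ cong (λ n → suc k * k ! * (n C suc k)) (+-suc a k) ⟨
  suc k * k ! * ((a + suc k) C suc k) ∎
  where open ≤-Reasoning

^-distribʳ-* : ∀ k a b → (a * b) ^ k ≡ a ^ k * b ^ k
^-distribʳ-* zero    a b = refl
^-distribʳ-* (suc k) a b = trans (cong (a * b *_) (^-distribʳ-* k a b)) ([m*n]*[o*p]≡[m*o]*[n*p] a b (a ^ k) (b ^ k))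

-- For n at least 2k, the number n - k is at least n/2; the powers of 2 pay for this. It feeds the
-- lower constant of the Θ statement.
n^k≤2^k*k!*nCk : ∀ n k → k + k ≤ n → n ^ k ≤ 2 ^ k * k ! * (n C k)
n^k≤2^k*k!*nCk n k 2k≤n = begin
  n ^ k                              ≤⟨ ^-monoˡ-≤ k n≤2a ⟩
  (2 * a) ^ k                        ≡⟨ ^-distribʳ-* k 2 a ⟩
  2 ^ k * a ^ k                      ≤⟨ *-monoʳ-≤ (2 ^ k) (a^k≤k!*[a+k]Ck a k) ⟩
  2 ^ k * (k ! * ((a + k) C k))      ≡⟨ *-assoc (2 ^ k) (k !) ((a + k) C k) ⟨
  2 ^ k * k ! * ((a + k) C k)        ≡⟨ cong (λ n → 2 ^ k * k ! * (n C k)) a+k≡n ⟩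
  2 ^ k * k ! * (n C k)              ∎
  where
  open ≤-Reasoning
  a = n ∸ k
  a+k≡n : a + k ≡ n
  a+k≡n = m∸n+n≡m (≤-trans (m≤m+n k k) 2k≤n)
  n≤2a : n ≤ 2 * a
  n≤2a = begin
    n          ≡⟨ a+k≡n ⟨
    a + k      ≤⟨ +-monoʳ-≤ a (m+n≤o⇒m≤o∸n k 2k≤n) ⟩
    a + a      ≡⟨ cong (_+_ a) (+-identityʳ a) ⟨
    2 * a      ∎

nCk≤n^k : ∀ n k → n C k ≤ n ^ k
nCk≤n^k n zero = ≤-refl
nCk≤n^k zero (suc k) = z≤n
nCk≤n^k (suc n) (suc k) = begin
  suc n C suc k               ≤⟨ m≤m+n (suc n C suc k) _ ⟩
  suc k * (suc n C suc k)     ≡⟨ [k+1]*[n+1]C[k+1]≡[n+1]*nCk n k ⟩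
  suc n * (n C k)             ≤⟨ *-monoʳ-≤ (suc n) (nCk≤n^k n k) ⟩
  suc n * n ^ k               ≤⟨ *-monoʳ-≤ (suc n) (^-monoˡ-≤ k (n≤1+n n)) ⟩
  suc n * suc n ^ k ∎
  where open ≤-Reasoning

nCk>0 : ∀ {n k} → k ≤ n → 0 < n C k
nCk>0 {n} {zero} _ = s≤s z≤n
nCk>0 {suc n} {suc k} (s≤s k≤n) = begin
  1                     ≤⟨ nCk>0 k≤n ⟩
  n C k                 ≤⟨ m≤m+n (n C k) (n C suc k) ⟩
  n C k + n C suc k     ≡⟨ nCk+nC[k+1]≡[n+1]C[k+1] n k ⟩
  suc n C suc k ∎
  where open ≤-Reasoning

-- Monochromatic copies

StrictlyIncreasing : Vec (Fin n) k → Set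
StrictlyIncreasing f = ∀ i j → i <ᶠ j → lookup f i <ᶠ lookup f j

reflects-< : ∀ (f : Vec (Fin n) k) → StrictlyIncreasing f → ∀ {i j} → lookup f i <ᶠ lookup f j → i <ᶠ j
reflects-< f inc {i} {j} fi<fj with <ᶠ-cmp i j
... | tri< i<j _ _ = i<j
... | tri≈ _ refl _ = contradiction fi<fj (<-irrefl refl)
... | tri> _ _ j<i = contradiction fi<fj (<-asym (inc j i j<i))

increasing-injective : ∀ (f : Vec (Fin n) k) → StrictlyIncreasing f → ∀ {i j} → lookup f i ≡ lookup f j → i ≡ j
increasing-injective f inc {i} {j} eq with <ᶠ-cmp i j
... | tri< i<j _ _ = contradiction (cong toℕ eq) (<⇒≢ (inc i j i<j))
... | tri≈ _ i≡j _ = i≡j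
... | tri> _ _ j<i = contradiction (cong toℕ (sym eq)) (<⇒≢ (inc j i j<i))

-- Each value exceeds the value at the preceding index. Composing with `inject₁` restricts σ to the
-- indices for which the induction hypothesis is available.
increasing⇒inflationary : ∀ (σ : Fin k → Fin l) → (∀ i j → i <ᶠ j → σ i <ᶠ σ j) → ∀ i → toℕ i ≤ toℕ (σ i)
increasing⇒inflationary σ inc zero = z≤n
increasing⇒inflationary σ inc (suc i) = begin
  suc (toℕ i)               ≡⟨ cong suc (toℕ-inject₁ i) ⟨
  suc (toℕ (inject₁ i))     ≤⟨ s≤s ih ⟩
  suc (toℕ (σ (inject₁ i))) ≤⟨ inc (inject₁ i) (suc i) (s≤s (≤-reflexive (toℕ-inject₁ i))) ⟩
  toℕ (σ (suc i))           ∎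
  where
  open ≤-Reasoning
  σ′-inc : ∀ a b → a <ᶠ b → σ (inject₁ a) <ᶠ σ (inject₁ b)
  σ′-inc a b a<b = inc (inject₁ a) (inject₁ b) (subst₂ _<_ (sym (toℕ-inject₁ a)) (sym (toℕ-inject₁ b)) a<b)
  ih : toℕ (inject₁ i) ≤ toℕ (σ (inject₁ i))
  ih = subst (_≤ toℕ (σ (inject₁ i))) (sym (toℕ-inject₁ i)) (increasing⇒inflationary (σ ∘ inject₁) σ′-inc i)

-- Equal images let f factor as g ∘ σ. Since g reflects the order, σ is strictly increasing, hence
-- inflationary, and g (σ i) lies above g i.
increasing-image-≤ : ∀ (f g : Vec (Fin n) k) {S : Subset n} → StrictlyIncreasing f → StrictlyIncreasing g →
                     HasImage f S → HasImage g S → ∀ i → lookup g i ≤ᶠ lookup f i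
increasing-image-≤ f g inc-f inc-g im-f im-g i = begin
  toℕ (lookup g i)      ≤⟨ g-mono (increasing⇒inflationary σ σ-inc i) ⟩
  toℕ (lookup g (σ i))  ≡⟨ cong toℕ (gσ≡f i) ⟩
  toℕ (lookup f i)      ∎
  where
  open ≤-Reasoning
  factor : ∀ i → ∃[ j ] lookup g j ≡ lookup f i
  factor i = Equivalence.to (im-g (lookup f i)) (Equivalence.from (im-f (lookup f i)) (i , refl))
  σ = proj₁ ∘ factor
  gσ≡f = proj₂ ∘ factor
  σ-inc : ∀ i j → i <ᶠ j → σ i <ᶠ σ j
  σ-inc i j i<j = reflects-< g inc-g (subst (lookup g (σ i) <ᶠ_) (sym (gσ≡f j)) (subst (_<ᶠ lookup f j) (sym (gσ≡f i)) (inc-f i j i<j)))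
  g-mono : ∀ {i j} → i ≤ᶠ j → lookup g i ≤ᶠ lookup g j
  g-mono {i} {j} i≤j with <ᶠ-cmp i j
  ... | tri< i<j _ _ = <⇒≤ (inc-g i j i<j)
  ... | tri≈ _ refl _ = ≤-refl
  ... | tri> _ _ j<i = contradiction i≤j (<⇒≱ j<i)

increasing-image-unique : ∀ (f g : Vec (Fin n) k) {S : Subset n} → StrictlyIncreasing f → StrictlyIncreasing g →
                          HasImage f S → HasImage g S → f ≡ g
increasing-image-unique f g inc-f inc-g im-f im-g = begin
  f                   ≡⟨ tabulate∘lookup f ⟨
  tabulate (lookup f) ≡⟨ tabulate-cong (λ i → toℕ-injective (≤-antisym (increasing-image-≤ g f inc-g inc-f im-g im-f i) (increasing-image-≤ f g inc-f inc-g im-f im-g i))) ⟩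
  tabulate (lookup g) ≡⟨ tabulate∘lookup g ⟩
  g                   ∎
  where open ≡-Reasoning

ind-∈? : ∀ (S : Subset n) v → ind (v ∈? S) ≡ (if lookup S v then 1 else 0)
ind-∈? S v with v ∈? S
... | yes v∈S = cong (if_then 1 else 0) (sym ([]=⇒lookup v∈S))
... | no v∉S with lookup S v in eq
...   | true  = contradiction (lookup⇒[]= v S eq) v∉S
...   | false = refl

count-∈ : ∀ (S : Subset n) → count (_∈? S) (allFin n) ≡ ∣ S ∣
count-∈ {n} S = trans (∑-cong (allFin n) (ind-∈? S)) (trans (∑-lookup S 1) (*-identityʳ ∣ S ∣))

∣image∣ : ∀ (f : Vec (Fin n) k) {S} → StrictlyIncreasing f → HasImage f S → ∣ S ∣ ≡ k
∣image∣ {n} {k} f {S} inc im = begin-equality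
  ∣ S ∣                             ≡⟨ count-∈ S ⟨
  count (_∈? S) (allFin n)          ≡⟨ ≤-antisym
     (count-≤ (_∈? S) (λ _ → yes tt) (λ v i → lookup f i ≟ᶠ v) (allFin⁺ n)
       (λ v v∈S → let i , eq = Equivalence.to (im v) v∈S in i , ∈-allFin i , tt , eq)
       (λ v v′ i _ _ eq eq′ → trans (sym eq) eq′))
     (count-≤ (λ _ → yes tt) (_∈? S) (λ i v → lookup f i ≟ᶠ v) (allFin⁺ k)
       (λ i _ → lookup f i , ∈-allFin (lookup f i) , Equivalence.from (im (lookup f i)) (i , refl) , refl)
       (λ i j v _ _ eq eq′ → increasing-injective f inc (trans eq (sym eq′)))) ⟩
  ∑ (allFin k) (λ _ → 1)            ≡⟨ ∑-1 (allFin k) ⟩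
  length (allFin k)                 ≡⟨ length-allFin k ⟩
  k                                 ∎
  where open ≤-Reasoning

-- Pullback along a vertex map. It serves three purposes: deleting a vertex (`punchIn v`), doubling
-- one (`pinch v`), and removing an edge from a matching (`avoid j`).
_⟨_⟩ : Matrix X n → (Fin k → Fin n) → Matrix X k
M ⟨ φ ⟩ = tabulate λ i → tabulate λ j → entry M (φ i) (φ j)

entry-⟨⟩ : ∀ (M : Matrix X n) (φ : Fin k → Fin n) i j → entry (M ⟨ φ ⟩) i j ≡ entry M (φ i) (φ j)
entry-⟨⟩ M φ i j = trans (cong (λ r → lookup r j) (lookup∘tabulate _ i)) (lookup∘tabulate _ j)

entries-injective : ∀ (M N : Matrix X n) → (∀ i j → entry M i j ≡ entry N i j) → M ≡ N
entries-injective M N eq = lookup-injective (λ i → lookup-injective (eq i))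
  where
  lookup-injective : ∀ {Y : Set} {u v : Vec Y k} → (∀ i → lookup u i ≡ lookup v i) → u ≡ v
  lookup-injective {u = u} {v} eq = trans (sym (tabulate∘lookup u)) (trans (tabulate-cong eq) (tabulate∘lookup v))

-- The embedding of the copy is composed with φ. Monotonicity of φ is asked only on S, because
-- `pinch v` is not injective on all vertices.
pushforward : ∀ m (χ : Coloring n) (φ : Fin k → Fin n) {S : Subset k} {S′ : Subset n} →
  (∀ u w → u ∈ S → w ∈ S → u <ᶠ w → φ u <ᶠ φ w) →
  (∀ v → v ∈ S′ → ∃[ u ] (u ∈ S × φ u ≡ v)) →
  (∀ u → u ∈ S → φ u ∈ S′) →
  ∀ H → IsMonoCopy m (χ ⟨ φ ⟩) (H , S) → IsMonoCopy m χ (H , S′)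
pushforward m χ φ {S} {S′} inc onto into H (H∈𝔅 , a , f , (f-inc , f-col) , im) =
  H∈𝔅 , a , tabulate (φ ∘ lookup f) ,
  ((λ i j i<j → subst (λ x → x <ᶠ _) (sym (lookup-φf i)) (subst (φ (lookup f i) <ᶠ_) (sym (lookup-φf j))
      (inc _ _ (f∈S i) (f∈S j) (f-inc i j i<j)))) ,
   (λ i j i<j adj → trans (cong₂ (entry χ) (lookup-φf i) (lookup-φf j))
      (trans (sym (entry-⟨⟩ χ φ (lookup f i) (lookup f j))) (f-col i j i<j adj)))) ,
  (λ v → mk⇔ (λ v∈S′ → let u , u∈S , φu≡v = onto v v∈S′
                           i , fi≡u = Equivalence.to (im u) u∈S
                       in i , trans (lookup-φf i) (trans (cong φ fi≡u) φu≡v))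
             (λ (i , eq) → subst (_∈ S′) (trans (sym (lookup-φf i)) eq) (into _ (f∈S i))))
  where
  lookup-φf : ∀ i → lookup (tabulate (φ ∘ lookup f)) i ≡ φ (lookup f i)
  lookup-φf = lookup∘tabulate (φ ∘ lookup f)
  f∈S : ∀ i → lookup f i ∈ S
  f∈S i = Equivalence.from (im (lookup f i)) (i , refl)

monoCopy-size : ∀ m (χ : Coloring n) H {S} → IsMonoCopy m χ (H , S) → ∣ S ∣ ≡ 2 * m
monoCopy-size m χ H (_ , _ , f , (inc , _) , im) = ∣image∣ f inc im

-- Counting copies on a fixed vertex set

matrices : ∀ k → List (AdjacencyMatrix k)
matrices = allMatrices (false ∷ true ∷ [])

opaque
  -- Opaque because the arguments use only the estimates that unfold it and never evaluate the
  -- underlying decision procedure.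
  #on : ℕ → Coloring n → Subset n → ℕ
  #on m χ S = count (λ H → IsMonoCopy? m χ (H , S)) (matrices (2 * m))

#𝔅 : ℕ → ℕ
#𝔅 m = count (In𝔅? m) (matrices (2 * m))

opaque
  unfolding #on

  #monoCopies≡ : ∀ m (χ : Coloring n) → #monoCopies m χ ≡ ∑ (subsets n) (#on m χ)
  #monoCopies≡ {n} m χ = begin
    #monoCopies m χ
      ≡⟨ length-filter≡count (IsMonoCopy? m χ) (cartesianProduct Hs (subsets n)) ⟩
    count (IsMonoCopy? m χ) (cartesianProduct Hs (subsets n))
      ≡⟨ ∑-cartesianProductWith _,_ Hs (subsets n) _ ⟩
    ∑ Hs (λ H → ∑ (subsets n) (λ S → ind (IsMonoCopy? m χ (H , S))))
      ≡⟨ ∑-swap Hs (subsets n) _ ⟩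
    ∑ (subsets n) (#on m χ) ∎
    where
    open ≡-Reasoning
    Hs : List (AdjacencyMatrix (2 * m))
    Hs = matrices (2 * m)

  #on-monotone : ∀ m (χ : Coloring n) (χ′ : Coloring k) S S′ →
    (∀ H → IsMonoCopy m χ (H , S) → IsMonoCopy m χ′ (H , S′)) → #on m χ S ≤ #on m χ′ S′
  #on-monotone m χ χ′ S S′ = count-mono (λ H → IsMonoCopy? m χ (H , S)) (λ H → IsMonoCopy? m χ′ (H , S′)) (matrices (2 * m))

  #on≡0 : ∀ m (χ : Coloring n) S → ∣ S ∣ ≢ 2 * m → #on m χ S ≡ 0
  #on≡0 m χ S neq = count≡0 (λ H → IsMonoCopy? m χ (H , S)) (matrices (2 * m)) (λ H c → neq (monoCopy-size m χ H c))

  #on≤#𝔅 : ∀ m (χ : Coloring n) S → #on m χ S ≤ #𝔅 m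
  #on≤#𝔅 m χ S = count-mono (λ H → IsMonoCopy? m χ (H , S)) (In𝔅? m) (matrices (2 * m)) (λ _ → proj₁)

-- Copies live only on sets of size 2m, so the weights produced by `∑∋-total` become the constant
-- 2m.
∣S∣*#on : ∀ m (χ : Coloring n) S → ∣ S ∣ * #on m χ S ≡ 2 * m * #on m χ S
∣S∣*#on m χ S with ∣ S ∣ ≟ 2 * m
... | yes eq = cong (_* #on m χ S) eq
... | no neq rewrite #on≡0 m χ S neq = trans (*-zeroʳ ∣ S ∣) (sym (*-zeroʳ (2 * m)))

#on≤ : ∀ m (χ : Coloring n) S → #on m χ S ≤ ind (∣ S ∣ ≟ 2 * m) * #𝔅 m
#on≤ m χ S with ∣ S ∣ ≟ 2 * m
... | yes _  = ≤-trans (#on≤#𝔅 m χ S) (≤-reflexive (sym (*-identityˡ _)))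
... | no neq = ≤-reflexive (#on≡0 m χ S neq)

#on-pushforward : ∀ m (χ : Coloring n) (φ : Fin k → Fin n) {S : Subset k} {S′ : Subset n} →
  (∀ u w → u ∈ S → w ∈ S → u <ᶠ w → φ u <ᶠ φ w) →
  (∀ v → v ∈ S′ → ∃[ u ] (u ∈ S × φ u ≡ v)) →
  (∀ u → u ∈ S → φ u ∈ S′) →
  #on m (χ ⟨ φ ⟩) S ≤ #on m χ S′
#on-pushforward m χ φ {S} {S′} inc onto into =
  #on-monotone m (χ ⟨ φ ⟩) χ S S′ (pushforward m χ φ inc onto into)

-- Deleting and cloning a vertex

punchIn-mono-< : ∀ (v : Fin (suc n)) i j → i <ᶠ j → punchIn v i <ᶠ punchIn v j
punchIn-mono-< v i j i<j = ≰⇒> (λ le → <⇒≱ i<j (punchIn-cancel-≤ v j i le))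

data InsertView {n} (v : Fin (suc n)) : Fin (suc n) → Set where
  new : InsertView v v
  old : ∀ w → InsertView v (punchIn v w)

insertView : ∀ (v u : Fin (suc n)) → InsertView v u
insertView v u with v ≟ᶠ u
... | yes refl = new
... | no v≢u   = subst (InsertView v) (punchIn-punchOut v≢u) (old (punchOut v≢u))

∈-insertAt-new : ∀ (S : Subset n) v → v ∈ insertAt S v inside
∈-insertAt-new S v = lookup⇒[]= v _ (insertAt-lookup S v inside)

∉-insertAt-new : ∀ (S : Subset n) v → v ∉ insertAt S v outside
∉-insertAt-new S v v∈ with () ← trans (sym ([]=⇒lookup v∈)) (insertAt-lookup S v outside)

∈-insertAt-old⁺ : ∀ {S : Subset n} {v b w} → w ∈ S → punchIn v w ∈ insertAt S v b
∈-insertAt-old⁺ {S = S} {v} {b} {w} w∈S = lookup⇒[]= _ _ (trans (insertAt-punchIn S v b w) ([]=⇒lookup w∈S))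

∈-insertAt-old⁻ : ∀ {S : Subset n} {v b w} → punchIn v w ∈ insertAt S v b → w ∈ S
∈-insertAt-old⁻ {S = S} {v} {b} {w} w∈ = lookup⇒[]= _ _ (trans (sym (insertAt-punchIn S v b w)) ([]=⇒lookup w∈))

#on-delete : ∀ m (χ : Coloring (suc n)) v S → #on m (χ ⟨ punchIn v ⟩) S ≤ #on m χ (insertAt S v outside)
#on-delete m χ v S = #on-pushforward m χ (punchIn v)
  (λ u w _ _ → punchIn-mono-< v u w) onto (λ u → ∈-insertAt-old⁺)
  where
  onto : ∀ u → u ∈ insertAt S v outside → ∃[ w ] (w ∈ S × punchIn v w ≡ u)
  onto u u∈ with insertView v u
  ... | new   = contradiction u∈ (∉-insertAt-new S v)
  ... | old w = w , ∈-insertAt-old⁻ u∈ , refl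

pinch-punchIn : ∀ (v : Fin n) w → pinch v (punchIn (inject₁ v) w) ≡ w
pinch-punchIn zero w = refl
pinch-punchIn (suc v) zero = refl
pinch-punchIn (suc v) (suc w) = cong suc (pinch-punchIn v w)

pinch-inject₁ : ∀ (v : Fin n) → pinch v (inject₁ v) ≡ v
pinch-inject₁ zero = refl
pinch-inject₁ (suc v) = cong suc (pinch-inject₁ v)

punchIn-inject₁ : ∀ (v : Fin n) → punchIn (inject₁ v) v ≡ suc v
punchIn-inject₁ zero = refl
punchIn-inject₁ (suc v) = cong suc (punchIn-inject₁ v)

-- The twins are `inject₁ v` and `suc v`. Without the first one, `pinch v` is an order isomorphism
-- back to the original vertices.
#on-clone-outside : ∀ m (χ : Coloring n) v S → #on m (χ ⟨ pinch v ⟩) (insertAt S (inject₁ v) outside) ≤ #on m χ S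
#on-clone-outside m χ v S = #on-pushforward m χ (pinch v) inc
  (λ w w∈S → punchIn (inject₁ v) w , ∈-insertAt-old⁺ w∈S , pinch-punchIn v w) into
  where
  into : ∀ u → u ∈ insertAt S (inject₁ v) outside → pinch v u ∈ S
  into u u∈ with insertView (inject₁ v) u
  ... | new   = contradiction u∈ (∉-insertAt-new S _)
  ... | old w = subst (_∈ S) (sym (pinch-punchIn v w)) (∈-insertAt-old⁻ u∈)
  inc : ∀ u w → u ∈ insertAt S (inject₁ v) outside → w ∈ insertAt S (inject₁ v) outside → u <ᶠ w → pinch v u <ᶠ pinch v w
  inc u w u∈ w∈ u<w with insertView (inject₁ v) u | insertView (inject₁ v) w
  ... | new   | _     = contradiction u∈ (∉-insertAt-new S _)
  ... | old _ | new   = contradiction w∈ (∉-insertAt-new S _)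
  ... | old x | old y rewrite pinch-punchIn v x | pinch-punchIn v y =
    ≰⇒> (λ y≤x → <⇒≱ u<w (punchIn-mono-≤ (inject₁ v) y x y≤x))

-- As v is not in S, the second twin is absent, and the first twin plays the part of v.
#on-clone-inside : ∀ m (χ : Coloring n) v S → v ∉ S →
  #on m (χ ⟨ pinch v ⟩) (insertAt S (inject₁ v) inside) ≤ #on m χ (S [ v ]≔ inside)
#on-clone-inside m χ v S v∉S = #on-pushforward m χ (pinch v) inc onto into
  where
  S⁺ = insertAt S (inject₁ v) inside
  ∈S⇒∈S[v] : ∀ w → w ∈ S → w ∈ S [ v ]≔ inside
  ∈S⇒∈S[v] w w∈S = lookup⇒[]= w _ (trans (lookup∘update′ (λ { refl → v∉S w∈S }) S inside) ([]=⇒lookup w∈S))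
  into : ∀ u → u ∈ S⁺ → pinch v u ∈ S [ v ]≔ inside
  into u u∈ with insertView (inject₁ v) u
  ... | new   = subst (_∈ S [ v ]≔ inside) (sym (pinch-inject₁ v)) (lookup⇒[]= v _ (lookup∘update v S inside))
  ... | old w = subst (_∈ S [ v ]≔ inside) (sym (pinch-punchIn v w)) (∈S⇒∈S[v] w (∈-insertAt-old⁻ u∈))
  onto : ∀ w → w ∈ S [ v ]≔ inside → ∃[ u ] (u ∈ S⁺ × pinch v u ≡ w)
  onto w w∈ with w ≟ᶠ v
  ... | yes refl = inject₁ v , ∈-insertAt-new S _ , pinch-inject₁ v
  ... | no w≢v   = punchIn (inject₁ v) w , ∈-insertAt-old⁺ (lookup⇒[]= w S (trans (sym (lookup∘update′ w≢v S inside)) ([]=⇒lookup w∈))) , pinch-punchIn v w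
  suc-v≢ : ∀ u → u ∈ S⁺ → suc v ≢ u
  suc-v≢ u u∈ refl = v∉S (∈-insertAt-old⁻ (subst (_∈ S⁺) (sym (punchIn-inject₁ v)) u∈))
  inc : ∀ u w → u ∈ S⁺ → w ∈ S⁺ → u <ᶠ w → pinch v u <ᶠ pinch v w
  -- `pinch v` is weakly monotone everywhere and injective away from `suc v`, which gives strictness
  -- on `S⁺`.
  inc u w u∈ w∈ u<w = ≤∧≢⇒< (pinch-mono-≤ v (<⇒≤ u<w))
    (λ eq → <⇒≢ u<w (cong toℕ (pinch-injective (suc-v≢ u u∈) (suc-v≢ w w∈) (toℕ-injective eq))))

-- For each v, the copies in an optimal coloring either avoid v, and there are at least M̄(n) of
-- these, or pass through v. Summed over v, the latter number 2m M̄(n+1), as every copy has 2m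
-- vertices.
M̄-delete : ∀ m n → suc n * M̄ m n + 2 * m * M̄ m (suc n) ≤ suc n * M̄ m (suc n)
M̄-delete m n = begin
  suc n * M̄ m n + 2 * m * M̄ m (suc n)
    ≡⟨ cong (λ x → x * M̄ m n + 2 * m * M̄ m (suc n)) (length-allFin (suc n)) ⟨
  length Vs * M̄ m n + 2 * m * M̄ m (suc n)
    ≡⟨ cong₂ _+_ (sym (∑-const Vs (M̄ m n))) (trans (cong (2 * m *_) (#monoCopies≡ m χ)) (sym (∑-*ˡ (subsets (suc n)) (2 * m) (#on m χ)))) ⟩
  ∑ Vs (λ _ → M̄ m n) + ∑ (subsets (suc n)) (λ S → 2 * m * #on m χ S)
    ≤⟨ +-mono-≤ (∑-mono Vs delete) (≤-reflexive (∑-cong (subsets (suc n)) (λ S → sym (∣S∣*#on m χ S)))) ⟩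
  ∑ Vs (λ v → ∑ (subsets n) (λ S → #on m χ (insertAt S v outside))) + ∑ (subsets (suc n)) (λ S → ∣ S ∣ * #on m χ S)
    ≡⟨ cong (∑ Vs (λ v → ∑ (subsets n) (λ S → #on m χ (insertAt S v outside))) +_) (∑∋-total (#on m χ)) ⟨
  ∑ Vs (λ v → ∑ (subsets n) (λ S → #on m χ (insertAt S v outside))) + ∑ Vs (_∑∋ #on m χ)
    ≡⟨ ∑-+ Vs (λ v → ∑ (subsets n) (λ S → #on m χ (insertAt S v outside))) (_∑∋ #on m χ) ⟨
  ∑ Vs (λ v → ∑ (subsets n) (λ S → #on m χ (insertAt S v outside)) + (v ∑∋ #on m χ))
    ≡⟨ ∑-cong Vs (λ v → cong (∑ (subsets n) (λ S → #on m χ (insertAt S v outside)) +_) (∑∋-insertAt v (#on m χ))) ⟩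
  ∑ Vs (λ v → ∑ (subsets n) (λ S → #on m χ (insertAt S v outside)) + ∑ (subsets n) (λ S → #on m χ (insertAt S v inside)))
    ≡⟨ ∑-cong Vs (λ v → trans (#monoCopies≡ m χ) (∑-subsets-insertAt v (#on m χ))) ⟨
  ∑ Vs (λ _ → M̄ m (suc n))
    ≡⟨ ∑-const Vs (M̄ m (suc n)) ⟩
  length Vs * M̄ m (suc n)
    ≡⟨ cong (_* M̄ m (suc n)) (length-allFin (suc n)) ⟩
  suc n * M̄ m (suc n) ∎
  where
  open ≤-Reasoning
  Vs = allFin (suc n)
  χ = optimalColoring m (suc n)
  delete : ∀ v → M̄ m n ≤ ∑ (subsets n) (λ S → #on m χ (insertAt S v outside))
  delete v = begin
    M̄ m n                                          ≤⟨ M̄-minimal m (χ ⟨ punchIn v ⟩) ⟩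
    #monoCopies m (χ ⟨ punchIn v ⟩)                ≡⟨ #monoCopies≡ m (χ ⟨ punchIn v ⟩) ⟩
    ∑ (subsets n) (#on m (χ ⟨ punchIn v ⟩))        ≤⟨ ∑-mono (subsets n) (#on-delete m χ v) ⟩
    ∑ (subsets n) (λ S → #on m χ (insertAt S v outside)) ∎

∣insertAt∣ : ∀ (S : Subset n) v → ∣ insertAt S v inside ∣ ≡ suc ∣ S ∣
∣insertAt∣ S zero = refl
∣insertAt∣ (outside ∷ S) (suc v) = ∣insertAt∣ S v
∣insertAt∣ (inside ∷ S) (suc v) = cong suc (∣insertAt∣ S v)

size*indicator : ∀ (S : Subset n) k → ∣ S ∣ * ind (∣ S ∣ ≟ k) ≡ k * ind (∣ S ∣ ≟ k)
size*indicator S k with ∣ S ∣ ≟ k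
... | yes eq = cong (_* 1) eq
... | no _   = trans (*-zeroʳ ∣ S ∣) (sym (*-zeroʳ k))

≤-if : ∀ b {x y z} → (b ≡ true → x ≤ z) → (b ≡ false → x ≤ y) → x ≤ (if b then 0 else y) + (if b then z else 0)
≤-if true  x≤z _   = x≤z refl
≤-if false _   x≤y = m≤n⇒m≤n+o 0 (x≤y refl)

-- In χ ⟨ pinch v ⟩ the vertex v is doubled.  A copy avoids the first twin, or it contains only the
-- first twin, or it contains both; the term v ∑∋ both is a crude bound for the last kind.
M̄-clone : ∀ m n {k} → 2 * m ≡ suc k → n * M̄ m (suc n) ≤ (n + 2 * m) * M̄ m n + #𝔅 m * (k * (n C k))
M̄-clone m n {k} 2m≡1+k = begin
  n * M̄ m (suc n)
    ≡⟨ cong (_* M̄ m (suc n)) (length-allFin n) ⟨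
  length Vs * M̄ m (suc n)
    ≡⟨ ∑-const Vs (M̄ m (suc n)) ⟨
  ∑ Vs (λ _ → M̄ m (suc n))
    ≤⟨ ∑-mono Vs clone ⟩
  ∑ Vs (λ v → M̄ m n + ((v ∑∋ #on m χ) + (v ∑∋ both)))
    ≡⟨ ∑-+ Vs (λ _ → M̄ m n) (λ v → (v ∑∋ #on m χ) + (v ∑∋ both)) ⟩
  ∑ Vs (λ _ → M̄ m n) + ∑ Vs (λ v → (v ∑∋ #on m χ) + (v ∑∋ both))
    ≡⟨ cong₂ _+_ (trans (∑-const Vs (M̄ m n)) (cong (_* M̄ m n) (length-allFin n)))
         (trans (∑-+ Vs (_∑∋ #on m χ) (_∑∋ both)) (cong₂ _+_ total-on total-both)) ⟩
  n * M̄ m n + (2 * m * M̄ m n + #𝔅 m * (k * (n C k)))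
    ≡⟨ +-assoc (n * M̄ m n) _ _ ⟨
  n * M̄ m n + 2 * m * M̄ m n + #𝔅 m * (k * (n C k))
    ≡⟨ cong (_+ #𝔅 m * (k * (n C k))) (*-distribʳ-+ (M̄ m n) n (2 * m)) ⟨
  (n + 2 * m) * M̄ m n + #𝔅 m * (k * (n C k)) ∎
  where
  open ≤-Reasoning
  Vs = allFin n
  χ = optimalColoring m n
  both : Subset n → ℕ
  both S = #𝔅 m * ind (∣ S ∣ ≟ k)

  total-on : ∑ Vs (_∑∋ #on m χ) ≡ 2 * m * M̄ m n
  total-on = trans (∑∋-total (#on m χ)) (trans (∑-cong (subsets n) (∣S∣*#on m χ))
    (trans (∑-*ˡ (subsets n) (2 * m) (#on m χ)) (cong (2 * m *_) (sym (#monoCopies≡ m χ)))))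

  total-both : ∑ Vs (_∑∋ both) ≡ #𝔅 m * (k * (n C k))
  total-both = begin-equality
    ∑ Vs (_∑∋ both)                                           ≡⟨ ∑∋-total both ⟩
    ∑ (subsets n) (λ S → ∣ S ∣ * (#𝔅 m * ind (∣ S ∣ ≟ k)))    ≡⟨ ∑-cong (subsets n) (λ S → trans (x∙yz≈y∙xz ∣ S ∣ (#𝔅 m) (ind (∣ S ∣ ≟ k))) (cong (#𝔅 m *_) (size*indicator S k))) ⟩
    ∑ (subsets n) (λ S → #𝔅 m * (k * ind (∣ S ∣ ≟ k)))        ≡⟨ ∑-*ˡ (subsets n) (#𝔅 m) (λ S → k * ind (∣ S ∣ ≟ k)) ⟩
    #𝔅 m * ∑ (subsets n) (λ S → k * ind (∣ S ∣ ≟ k))          ≡⟨ cong (#𝔅 m *_) (∑-*ˡ (subsets n) k (λ S → ind (∣ S ∣ ≟ k))) ⟩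
    #𝔅 m * (k * count (λ S → ∣ S ∣ ≟ k) (subsets n))          ≡⟨ cong (λ x → #𝔅 m * (k * x)) (#subsets-ofSize n k) ⟩
    #𝔅 m * (k * (n C k))                                      ∎

  on-both : ∀ v S → #on m (χ ⟨ pinch v ⟩) (insertAt S (inject₁ v) inside) ≤ both S
  on-both v S = begin
    #on m (χ ⟨ pinch v ⟩) S⁺          ≤⟨ #on≤ m (χ ⟨ pinch v ⟩) S⁺ ⟩
    ind (∣ S⁺ ∣ ≟ 2 * m) * #𝔅 m       ≡⟨ *-comm (ind (∣ S⁺ ∣ ≟ 2 * m)) (#𝔅 m) ⟩
    #𝔅 m * ind (∣ S⁺ ∣ ≟ 2 * m)       ≤⟨ *-monoʳ-≤ (#𝔅 m) (ind-mono (∣ S⁺ ∣ ≟ 2 * m) (∣ S ∣ ≟ k)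
                                            (λ eq → suc-injective (trans (sym (∣insertAt∣ S (inject₁ v))) (trans eq 2m≡1+k)))) ⟩
    #𝔅 m * ind (∣ S ∣ ≟ k)            ∎
    where S⁺ = insertAt S (inject₁ v) inside

  on-inside : ∀ v S → #on m (χ ⟨ pinch v ⟩) (insertAt S (inject₁ v) inside) ≤
              (if lookup S v then 0 else #on m χ (S [ v ]≔ inside)) + (if lookup S v then both S else 0)
  on-inside v S = ≤-if (lookup S v) (λ _ → on-both v S)
    (λ eq → #on-clone-inside m χ v S (λ v∈S → contradiction (trans (sym ([]=⇒lookup v∈S)) eq) λ ()))

  clone : ∀ v → M̄ m (suc n) ≤ M̄ m n + ((v ∑∋ #on m χ) + (v ∑∋ both))
  clone v = begin
    M̄ m (suc n)
      ≤⟨ M̄-minimal m (χ ⟨ pinch v ⟩) ⟩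
    #monoCopies m (χ ⟨ pinch v ⟩)
      ≡⟨ trans (#monoCopies≡ m (χ ⟨ pinch v ⟩)) (∑-subsets-insertAt (inject₁ v) (#on m (χ ⟨ pinch v ⟩))) ⟩
    ∑ (subsets n) (λ S → #on m (χ ⟨ pinch v ⟩) (insertAt S (inject₁ v) outside)) +
    ∑ (subsets n) (λ S → #on m (χ ⟨ pinch v ⟩) (insertAt S (inject₁ v) inside))
      ≤⟨ +-mono-≤ (∑-mono (subsets n) (#on-clone-outside m χ v)) (∑-mono (subsets n) (on-inside v)) ⟩
    ∑ (subsets n) (#on m χ) +
    ∑ (subsets n) (λ S → (if lookup S v then 0 else #on m χ (S [ v ]≔ inside)) + (if lookup S v then both S else 0))
      ≡⟨ cong₂ _+_ (sym (#monoCopies≡ m χ)) (trans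
           (∑-+ (subsets n) (λ S → if lookup S v then 0 else #on m χ (S [ v ]≔ inside)) (λ S → if lookup S v then both S else 0))
           (cong (_+ (v ∑∋ both)) (∑∋-update v (#on m χ)))) ⟩
    M̄ m n + ((v ∑∋ #on m χ) + (v ∑∋ both)) ∎

-- A bound on a count may assume that one object exists. In `#vertexColorings-mono` that object
-- supplies the embedding shared by all others.
count-zero-or-witness : ∀ {P : X → Set} (P? : Decidable P) xs → count P? xs ≡ 0 ⊎ ∃ P
count-zero-or-witness P? [] = inj₁ refl
count-zero-or-witness P? (x ∷ xs) with P? x
... | yes px = inj₂ (x , px)
... | no _   = count-zero-or-witness P? xs

-- Perfect matchings

opaque
  isPerfectMatching? : Decidable (IsPerfectMatching {n})
  isPerfectMatching? H =
    ((all? λ i → all? λ j → Adj? H i j →-dec Adj? H j i) ×-dec (all? λ i → ¬? (Adj? H i i))) ×-dec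
    (all? λ i → any? λ j → Adj? H i j ×-dec
      map′ (λ g {y} → g y) (λ g y → g {y}) (all? λ y → Adj? H i y →-dec (j ≟ᶠ y)))

partner-unique : ∀ {H : AdjacencyMatrix n} → IsPerfectMatching H → ∀ i {j k} → Adj H i j → Adj H i k → j ≡ k
partner-unique (_ , partner) i ij ik with _ , _ , unique ← partner i = trans (sym (unique ij)) (unique ik)

Left Right : AdjacencyMatrix n → Fin n → Set
Left  H i = ∃[ j ] (i <ᶠ j × Adj H i j)
Right H i = ∃[ j ] (j <ᶠ i × Adj H i j)

Left? : ∀ (H : AdjacencyMatrix n) → Decidable (Left H)
Left? H i = any? λ j → (i <ᶠ? j) ×-dec Adj? H i j

Right? : ∀ (H : AdjacencyMatrix n) → Decidable (Right H)
Right? H i = any? λ j → (j <ᶠ? i) ×-dec Adj? H i j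

-- Every vertex is the smaller or the larger endpoint of its edge, and the matching sends larger
-- endpoints injectively to smaller ones.
#vertices≤2*#Left : ∀ (H : AdjacencyMatrix n) → IsPerfectMatching H → n ≤ 2 * count (Left? H) (allFin n)
#vertices≤2*#Left {n} H pm@((symm , irr) , partner) = begin
  n                                                         ≡⟨ length-allFin n ⟨
  length (allFin n)                                         ≡⟨ ∑-1 (allFin n) ⟨
  ∑ (allFin n) (λ _ → 1)                                    ≤⟨ ∑-mono (allFin n) left-or-right ⟩
  ∑ (allFin n) (λ i → ind (Left? H i) + ind (Right? H i))   ≡⟨ ∑-+ (allFin n) (λ i → ind (Left? H i)) (λ i → ind (Right? H i)) ⟩
  #L + count (Right? H) (allFin n)                          ≤⟨ +-monoʳ-≤ #L right≤left ⟩
  #L + #L                                                   ≡⟨ cong (#L +_) (+-identityʳ #L) ⟨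
  2 * #L                                                    ∎
  where
  open ≤-Reasoning
  #L = count (Left? H) (allFin n)
  left-or-right : ∀ i → 1 ≤ ind (Left? H i) + ind (Right? H i)
  left-or-right i with j , ij , _ ← partner i with <ᶠ-cmp i j
  ... | tri< i<j _ _ = m≤n⇒m≤n+o _ (≤-reflexive (sym (ind-yes (Left? H i) (j , i<j , ij))))
  ... | tri≈ _ refl _ = contradiction ij (irr i)
  ... | tri> _ _ j<i = m≤n⇒m≤o+n (ind (Left? H i)) (≤-reflexive (sym (ind-yes (Right? H i) (j , j<i , ij))))
  right≤left : count (Right? H) (allFin n) ≤ #L
  right≤left = count-≤ (Right? H) (Left? H) (Adj? H) (allFin⁺ n)
    (λ i (j , j<i , ij) → j , ∈-allFin j , (i , j<i , symm i j ij) , ij)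
    (λ i i′ j _ _ ij i′j → partner-unique {H = H} pm j (symm i j ij) (symm i′ j i′j))

Adj-⟨⟩⁺ : ∀ (H : AdjacencyMatrix n) (φ : Fin k → Fin n) i j → Adj H (φ i) (φ j) → Adj (H ⟨ φ ⟩) i j
Adj-⟨⟩⁺ H φ i j = subst T (sym (entry-⟨⟩ H φ i j))

Adj-⟨⟩⁻ : ∀ (H : AdjacencyMatrix n) (φ : Fin k → Fin n) i j → Adj (H ⟨ φ ⟩) i j → Adj H (φ i) (φ j)
Adj-⟨⟩⁻ H φ i j = subst T (entry-⟨⟩ H φ i j)

-- The increasing enumeration of what remains after `zero` and `suc j` are removed.
avoid : Fin (suc n) → Fin n → Fin (suc (suc n))
avoid j i = suc (punchIn j i)

avoid-¬zero : ∀ (H : AdjacencyMatrix (suc (suc n))) j → IsPerfectMatching H → Adj H zero (suc j) →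
              ∀ i → ¬ Adj H (avoid j i) zero
avoid-¬zero H j pm 0j i i0 =
  punchInᵢ≢i j i (suc-injectiveᶠ (partner-unique {H = H} pm zero (proj₁ (proj₁ pm) _ _ i0) 0j))

avoid-¬suc : ∀ (H : AdjacencyMatrix (suc (suc n))) j → IsPerfectMatching H → Adj H zero (suc j) →
             ∀ i → ¬ Adj H (avoid j i) (suc j)
avoid-¬suc H j pm 0j i ij
  with () ← partner-unique {H = H} pm (suc j) (proj₁ (proj₁ pm) _ _ ij) (proj₁ (proj₁ pm) _ _ 0j)

-- The removed vertices are each other's partners, so the partner of a remaining vertex remains.
removeEdge : ∀ (H : AdjacencyMatrix (suc (suc n))) j → IsPerfectMatching H → Adj H zero (suc j) →
             IsPerfectMatching (H ⟨ avoid j ⟩)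
removeEdge H j pm@((symm , irr) , partner) 0j =
  ((λ a b ab → Adj-⟨⟩⁺ H (avoid j) b a (symm _ _ (Adj-⟨⟩⁻ H (avoid j) a b ab))) ,
   (λ a aa → irr _ (Adj-⟨⟩⁻ H (avoid j) a a aa))) ,
  partner′
  where
  partner′ : ∀ i → ∃! _≡_ (Adj (H ⟨ avoid j ⟩) i)
  partner′ i with partner (avoid j i)
  ... | zero , i0 , _ = contradiction i0 (avoid-¬zero H j pm 0j i)
  ... | suc p , ip , unique with insertView j p
  ...   | new   = contradiction ip (avoid-¬suc H j pm 0j i)
  ...   | old w = w , Adj-⟨⟩⁺ H (avoid j) i w ip ,
                  λ {y} iy → punchIn-injective j w y (suc-injectiveᶠ (unique (Adj-⟨⟩⁻ H (avoid j) i y iy)))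

-- At `zero` and `suc j` adjacency is forced by the common edge; elsewhere it is read off from the
-- smaller matching.
removeEdge-⊆ : ∀ (H K : AdjacencyMatrix (suc (suc n))) j →
  IsPerfectMatching H → IsPerfectMatching K → Adj H zero (suc j) → Adj K zero (suc j) →
  H ⟨ avoid j ⟩ ≡ K ⟨ avoid j ⟩ → ∀ a b → Adj H a b → Adj K a b
removeEdge-⊆ H K j pmH pmK 0jH 0jK eq zero b 0b = subst (Adj K zero) (partner-unique {H = H} pmH zero 0jH 0b) 0jK
removeEdge-⊆ H K j pmH pmK 0jH 0jK eq (suc a) b ab with insertView j a
... | new = subst (Adj K (suc j)) (partner-unique {H = H} pmH (suc j) (proj₁ (proj₁ pmH) _ _ 0jH) ab) (proj₁ (proj₁ pmK) _ _ 0jK)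
removeEdge-⊆ H K j pmH pmK 0jH 0jK eq (suc _) zero ab | old w = contradiction ab (avoid-¬zero H j pmH 0jH w)
removeEdge-⊆ H K j pmH pmK 0jH 0jK eq (suc _) (suc b) ab | old w with insertView j b
... | new   = contradiction ab (avoid-¬suc H j pmH 0jH w)
... | old x = Adj-⟨⟩⁻ K (avoid j) w x (subst (λ M → Adj M w x) eq (Adj-⟨⟩⁺ H (avoid j) w x ab))

T-ext : ∀ {x y} → (T x → T y) → (T y → T x) → x ≡ y
T-ext {false} {false} _ _ = refl
T-ext {false} {true}  _ g with () ← g tt
T-ext {true}  {false} f _ with () ← f tt
T-ext {true}  {true}  _ _ = refl

removeEdge-injective : ∀ (H K : AdjacencyMatrix (suc (suc n))) j →
  IsPerfectMatching H → IsPerfectMatching K → Adj H zero (suc j) → Adj K zero (suc j) →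
  H ⟨ avoid j ⟩ ≡ K ⟨ avoid j ⟩ → H ≡ K
removeEdge-injective H K j pmH pmK 0jH 0jK eq = entries-injective H K λ a b →
  T-ext (removeEdge-⊆ H K j pmH pmK 0jH 0jK eq a b) (removeEdge-⊆ K H j pmK pmH 0jK 0jH (sym eq) a b)

bools-unique : Unique (false ∷ true ∷ [])
bools-unique = ((λ ()) All.∷ All.[]) ∷ (All.[] ∷ [])

∈-bools : ∀ b → b ∈ˡ (false ∷ true ∷ [])
∈-bools false = here refl
∈-bools true  = there (here refl)

matrices-unique : ∀ n → Unique (matrices n)
matrices-unique n = allVecs-unique (allVecs-unique bools-unique n) n

#matchings : ℕ → ℕ
#matchings n = count (isPerfectMatching? {n}) (matrices n)

#matchings-with-edge : ∀ n j →
  count (λ H → isPerfectMatching? H ×-dec Adj? H zero (suc j)) (matrices (suc (suc n))) ≤ #matchings n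
#matchings-with-edge n j = count-≤
  (λ H → isPerfectMatching? H ×-dec Adj? H zero (suc j)) (isPerfectMatching? {n})
  (λ H H′ → ≡-dec (≡-dec _≟ᵇ_) (H ⟨ avoid j ⟩) H′) (matrices-unique (suc (suc n)))
  (λ H (pm , 0j) → H ⟨ avoid j ⟩ , ∈-allMatrices ∈-bools (H ⟨ avoid j ⟩) , removeEdge H j pm 0j , refl)
  (λ H K _ (pmH , 0jH) (pmK , 0jK) eqH eqK → removeEdge-injective H K j pmH pmK 0jH 0jK (trans eqH (sym eqK)))

-- The matchings are classified by the partner of `zero`, for which there are n + 1 candidates.
#matchings-step : ∀ n → #matchings (suc (suc n)) ≤ suc n * #matchings n
#matchings-step n = begin
  #matchings (suc (suc n))
    ≤⟨ ∑-mono Hs (λ H → partner-of-zero H (isPerfectMatching? H)) ⟩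
  ∑ Hs (λ H → ∑ (allFin (suc n)) (λ j → ind (with-edge? j H)))
    ≡⟨ ∑-swap Hs (allFin (suc n)) (λ H j → ind (with-edge? j H)) ⟩
  ∑ (allFin (suc n)) (λ j → count (with-edge? j) Hs)
    ≤⟨ ∑-mono (allFin (suc n)) (#matchings-with-edge n) ⟩
  ∑ (allFin (suc n)) (λ _ → #matchings n)
    ≡⟨ ∑-const (allFin (suc n)) (#matchings n) ⟩
  length (allFin (suc n)) * #matchings n
    ≡⟨ cong (_* #matchings n) (length-allFin (suc n)) ⟩
  suc n * #matchings n ∎
  where
  open ≤-Reasoning
  Hs = matrices (suc (suc n))
  with-edge? : ∀ j → Decidable (λ H → IsPerfectMatching H × Adj H zero (suc j))
  with-edge? j H = isPerfectMatching? H ×-dec Adj? H zero (suc j)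
  partner-of-zero : ∀ H (pm? : Dec (IsPerfectMatching H)) → ind pm? ≤ count (λ j → with-edge? j H) (allFin (suc n))
  partner-of-zero H (no _) = z≤n
  partner-of-zero H (yes pm@((_ , irr) , partner)) with partner zero
  ... | zero  , loop , _ = contradiction loop (irr zero)
  ... | suc j , 0j , _ = count≥1 (λ j → with-edge? j H) (∈-allFin j) (pm , 0j)

2*suc : ∀ p → 2 * suc p ≡ suc (suc (2 * p))
2*suc p = cong suc (+-suc p (p + 0))

-- This is the bound (2p-1)!! = (2p)!/(2^p p!) with its denominator cleared.
#matchings-bound : ∀ p → #matchings (2 * p) * (2 ^ p * p !) ≤ (2 * p) !
#matchings-bound zero = ≤-trans (≤-reflexive (trans (*-identityʳ _) (+-identityʳ _))) (ind≤1 (isPerfectMatching? []))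
#matchings-bound (suc p) = subst (λ N → #matchings N * (2 ^ suc p * suc p !) ≤ N !) (sym (2*suc p)) (begin
  #matchings (suc (suc (2 * p))) * (2 ^ suc p * suc p !)
    ≤⟨ *-monoˡ-≤ (2 ^ suc p * suc p !) (#matchings-step (2 * p)) ⟩
  suc (2 * p) * #matchings (2 * p) * (2 * 2 ^ p * (suc p * p !))
    ≡⟨ regroup (suc (2 * p)) (#matchings (2 * p)) (2 ^ p) (suc p) (p !) ⟩
  2 * suc p * (suc (2 * p) * (#matchings (2 * p) * (2 ^ p * p !)))
    ≤⟨ *-monoʳ-≤ (2 * suc p) (*-monoʳ-≤ (suc (2 * p)) (#matchings-bound p)) ⟩
  2 * suc p * (suc (2 * p) * (2 * p) !)
    ≡⟨ cong (_* (suc (2 * p) * (2 * p) !)) (2*suc p) ⟩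
  suc (suc (2 * p)) * (suc (2 * p) * (2 * p) !) ∎)
  where
  open ≤-Reasoning
  regroup : ∀ a b c d e → a * b * (2 * c * (d * e)) ≡ 2 * d * (a * (b * (c * e)))
  regroup = solve-∀

hasOuterEdge? : Decidable (HasOuterEdge {n})
hasOuterEdge? {n} H = any? λ i → any? λ j → (toℕ i ≟ 0) ×-dec (suc (toℕ j) ≟ n) ×-dec Adj? H i j

-- The outer edge prescribes the partner of `zero`, so the factor n + 1 of `#matchings-step`
-- disappears.
#outer≤#matchings : ∀ n → count (λ H → isPerfectMatching? H ×-dec hasOuterEdge? H) (matrices (suc (suc n))) ≤ #matchings n
#outer≤#matchings n = ≤-trans
  (count-mono (λ H → isPerfectMatching? H ×-dec hasOuterEdge? H)
              (λ H → isPerfectMatching? H ×-dec Adj? H zero (suc (fromℕ n))) (matrices (suc (suc n)))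
              (λ H (pm , outer) → pm , outer-edge H outer))
  (#matchings-with-edge n (fromℕ n))
  where
  outer-edge : ∀ H → HasOuterEdge H → Adj H zero (suc (fromℕ n))
  outer-edge H (zero , j , _ , j≡last , 0j) =
    subst (Adj H zero) (toℕ-injective (trans (suc-injective j≡last) (cong suc (sym (toℕ-fromℕ n))))) 0j

#𝔅≤#matchings : ∀ p → #𝔅 (suc p) ≤ #matchings (2 * p)
#𝔅≤#matchings p = ≤-trans
  (count-mono (In𝔅? (suc p)) (λ H → isPerfectMatching? H ×-dec hasOuterEdge? H) (matrices (2 * suc p)) (λ _ → id))
  (subst (λ N → count (λ H → isPerfectMatching? H ×-dec hasOuterEdge? H) (matrices N) ≤ #matchings (2 * p))
         (sym (2*suc p)) (#outer≤#matchings (2 * p)))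

-- Averaging over the colorings in which the color of an edge depends only on its smaller endpoint

length-allVecs : ∀ (xs : List X) n → length (allVecs xs n) ≡ length xs ^ n
length-allVecs xs zero    = refl
length-allVecs xs (suc n) =
  trans (sym (∑-1 (allVecs xs (suc n))))
 (trans (∑-allVecs-suc xs n (λ _ → 1))
 (trans (∑-cong xs (λ _ → trans (∑-1 (allVecs xs n)) (length-allVecs xs n)))
        (∑-const xs (length xs ^ n))))

vertexColorings : ∀ n → List (Vec Color n)
vertexColorings = allVecs colors

ConstantOn : Subset n → Color → Vec Color n → Set
ConstantOn S a c = ∀ v → v ∈ S → lookup c v ≡ a

opaque
  constantOn? : ∀ (S : Subset n) a → Decidable (ConstantOn S a)
  constantOn? S a c = all? λ v → (v ∈? S) →-dec (lookup c v ≟ᶜ a)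

-- Each vertex of S has its color prescribed and every other vertex is free, which leaves 2^(n-∣S∣)
-- colorings.
#constantOn : ∀ (S : Subset n) a → 2 ^ ∣ S ∣ * count (constantOn? S a) (vertexColorings n) ≤ 2 ^ n
#constantOn [] a = ≤-trans (≤-reflexive (trans (*-identityˡ _) (+-identityʳ _))) (ind≤1 (constantOn? [] a []))
#constantOn {suc n} (outside ∷ S) a = begin
  2 ^ ∣ S ∣ * count (constantOn? (outside ∷ S) a) (vertexColorings (suc n))
    ≡⟨ cong (2 ^ ∣ S ∣ *_) (∑-allVecs-suc colors n (λ c → ind (constantOn? (outside ∷ S) a c))) ⟩
  2 ^ ∣ S ∣ * ∑ colors (λ b → count (λ c → constantOn? (outside ∷ S) a (b ∷ c)) (vertexColorings n))
    ≤⟨ *-monoʳ-≤ (2 ^ ∣ S ∣) (∑-mono colors (λ b → count-mono (λ c → constantOn? (outside ∷ S) a (b ∷ c)) (constantOn? S a)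
         (vertexColorings n) (λ c const v v∈S → const (suc v) (there v∈S)))) ⟩
  2 ^ ∣ S ∣ * (2 * #S)
    ≡⟨ x∙yz≈y∙xz (2 ^ ∣ S ∣) 2 #S ⟩
  2 * (2 ^ ∣ S ∣ * #S)
    ≤⟨ *-monoʳ-≤ 2 (#constantOn S a) ⟩
  2 ^ suc n ∎
  where
  open ≤-Reasoning
  #S = count (constantOn? S a) (vertexColorings n)
#constantOn {suc n} (inside ∷ S) a = begin
  2 * 2 ^ ∣ S ∣ * count (constantOn? (inside ∷ S) a) (vertexColorings (suc n))
    ≡⟨ cong (2 * 2 ^ ∣ S ∣ *_) (∑-allVecs-suc colors n (λ c → ind (constantOn? (inside ∷ S) a c))) ⟩
  2 * 2 ^ ∣ S ∣ * ∑ colors (λ b → count (λ c → constantOn? (inside ∷ S) a (b ∷ c)) (vertexColorings n))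
    ≤⟨ *-monoʳ-≤ (2 * 2 ^ ∣ S ∣) (∑-mono colors first-color) ⟩
  2 * 2 ^ ∣ S ∣ * ∑ colors (λ b → #S * ind (b ≟ᶜ a))
    ≡⟨ cong (2 * 2 ^ ∣ S ∣ *_) (trans (∑-*ˡ colors #S (λ b → ind (b ≟ᶜ a))) (trans (cong (#S *_) (one-color a)) (*-identityʳ #S))) ⟩
  2 * 2 ^ ∣ S ∣ * #S
    ≡⟨ *-assoc 2 (2 ^ ∣ S ∣) #S ⟩
  2 * (2 ^ ∣ S ∣ * #S)
    ≤⟨ *-monoʳ-≤ 2 (#constantOn S a) ⟩
  2 ^ suc n ∎
  where
  open ≤-Reasoning
  #S = count (constantOn? S a) (vertexColorings n)
  one-color : ∀ a → count (_≟ᶜ a) colors ≡ 1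
  one-color red  = refl
  one-color blue = refl
  first-color : ∀ b → count (λ c → constantOn? (inside ∷ S) a (b ∷ c)) (vertexColorings n) ≤ #S * ind (b ≟ᶜ a)
  first-color b with b ≟ᶜ a
  ... | yes _  = ≤-trans (count-mono (λ c → constantOn? (inside ∷ S) a (b ∷ c)) (constantOn? S a) (vertexColorings n)
                            (λ c const v v∈S → const (suc v) (there v∈S))) (≤-reflexive (sym (*-identityʳ #S)))
  ... | no b≢a = ≤-trans (≤-reflexive (count≡0 (λ c → constantOn? (inside ∷ S) a (b ∷ c)) (vertexColorings n)
                            (λ c const → b≢a (const zero here)))) z≤n

-- Only entries above the diagonal are read, so row u consists of the edges with smaller endpoint u;
-- hence constant rows.
fromVertexColoring : Vec Color n → Coloring n
fromVertexColoring {n} c = tabulate λ u → replicate n (lookup c u)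

entry-fromVertexColoring : ∀ (c : Vec Color n) u v → entry (fromVertexColoring c) u v ≡ lookup c u
entry-fromVertexColoring {n} c u v =
  trans (cong (λ row → lookup row v) (lookup∘tabulate (λ u → replicate n (lookup c u)) u)) (lookup-replicate v (lookup c u))

module _ {P : Fin n → Set} (P? : Decidable P) where

  comprehension : Subset n
  comprehension = tabulate (does ∘ P?)

  ∈-comprehension⁺ : ∀ v → P v → v ∈ comprehension
  ∈-comprehension⁺ v pv = lookup⇒[]= v comprehension (trans (lookup∘tabulate (does ∘ P?) v) (dec-true (P? v) pv))

  ∈-comprehension⁻ : ∀ v → v ∈ comprehension → P v
  ∈-comprehension⁻ v v∈ = does-true (P? v) (trans (sym (lookup∘tabulate (does ∘ P?) v)) ([]=⇒lookup v∈))
    where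
    does-true : ∀ {Q : Set} (Q? : Dec Q) → does Q? ≡ true → Q
    does-true (yes q) _ = q

-- The vertices whose colors decide whether the copy of H along f is monochromatic.
leftImage : AdjacencyMatrix k → Vec (Fin n) k → Subset n
leftImage H f = comprehension (λ v → any? λ i → Left? H i ×-dec (lookup f i ≟ᶠ v))

∣leftImage∣ : ∀ m (H : AdjacencyMatrix (2 * m)) (f : Vec (Fin n) (2 * m)) → IsPerfectMatching H → StrictlyIncreasing f →
              m ≤ ∣ leftImage H f ∣
∣leftImage∣ {n} m H f pm inc = *-cancelˡ-≤ 2 (begin
  2 * m                                        ≤⟨ #vertices≤2*#Left H pm ⟩
  2 * count (Left? H) (allFin (2 * m))         ≤⟨ *-monoʳ-≤ 2 (count-≤ (Left? H) (_∈? L) (λ i v → lookup f i ≟ᶠ v) (allFin⁺ (2 * m))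
      (λ i left → lookup f i , ∈-allFin (lookup f i) , ∈-comprehension⁺ inL? (lookup f i) (i , left , refl) , refl)
      (λ i j v _ _ eq eq′ → increasing-injective f inc (trans eq (sym eq′)))) ⟩
  2 * count (_∈? L) (allFin n)                 ≡⟨ cong (2 *_) (count-∈ L) ⟩
  2 * ∣ L ∣                                    ∎)
  where
  open ≤-Reasoning
  L = leftImage H f
  inL? : Decidable (λ v → ∃[ i ] (Left H i × lookup f i ≡ v))
  inL? v = any? λ i → Left? H i ×-dec (lookup f i ≟ᶠ v)

-- Distinct edges of H have distinct smaller endpoints, so monochromaticity fixes m independent colors.
monoCopy⇒constantOn : ∀ m (c : Vec Color n) H S f → StrictlyIncreasing f → HasImage f S →
  IsMonoCopy m (fromVertexColoring c) (H , S) → ∃[ a ] ConstantOn (leftImage H f) a c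
monoCopy⇒constantOn m c H S f inc im (_ , a , g , (g-inc , g-col) , g-im)
  -- S determines the embedding, so every vertex coloring that makes H monochromatic on S is
  -- constant on the same set.
  with refl ← increasing-image-unique f g inc g-inc im g-im =
  a , λ v v∈ → let i , (j , i<j , ij) , fi≡v = ∈-comprehension⁻ (λ v → any? λ i → Left? H i ×-dec (lookup f i ≟ᶠ v)) v v∈
               in trans (cong (lookup c) (sym fi≡v))
                 (trans (sym (entry-fromVertexColoring c (lookup f i) (lookup f j))) (g-col i j i<j ij))

-- Any admissible vertex coloring is constant, in one of two colors, on a fixed set of at least m
-- vertices. That leaves at most 2 · 2^(n-m) of them. The indicators on the right prepare the
-- summation over H and S.
#vertexColorings-mono : ∀ m H (S : Subset n) →
  2 ^ m * count (λ c → IsMonoCopy? m (fromVertexColoring c) (H , S)) (vertexColorings n) ≤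
  2 * 2 ^ n * (ind (∣ S ∣ ≟ 2 * m) * ind (In𝔅? m H))
#vertexColorings-mono {n} m H S
  with count-zero-or-witness (λ c → IsMonoCopy? m (fromVertexColoring c) (H , S)) (vertexColorings n)
... | inj₁ eq = ≤-trans (≤-reflexive (trans (cong (2 ^ m *_) eq) (*-zeroʳ (2 ^ m)))) z≤n
... | inj₂ (c₀ , mono₀@(H∈𝔅@(pm , _) , _ , f , (inc , _) , im)) = begin
  2 ^ m * count (λ c → IsMonoCopy? m (fromVertexColoring c) (H , S)) (vertexColorings n)
    ≤⟨ *-mono-≤ (^-monoʳ-≤ 2 (∣leftImage∣ m H f pm inc)) (∑-mono (vertexColorings n) some-color) ⟩
  2 ^ ∣ L ∣ * ∑ (vertexColorings n) (λ c → ∑ colors (λ a → ind (constantOn? L a c)))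
    ≡⟨ cong (2 ^ ∣ L ∣ *_) (∑-swap (vertexColorings n) colors (λ c a → ind (constantOn? L a c))) ⟩
  2 ^ ∣ L ∣ * ∑ colors (λ a → count (constantOn? L a) (vertexColorings n))
    ≡⟨ ∑-*ˡ colors (2 ^ ∣ L ∣) (λ a → count (constantOn? L a) (vertexColorings n)) ⟨
  ∑ colors (λ a → 2 ^ ∣ L ∣ * count (constantOn? L a) (vertexColorings n))
    ≤⟨ ∑-mono colors (#constantOn L) ⟩
  2 * 2 ^ n
    ≡⟨ *-identityʳ (2 * 2 ^ n) ⟨
  2 * 2 ^ n * 1
    ≡⟨ cong (2 * 2 ^ n *_) (cong₂ _*_ (ind-yes (∣ S ∣ ≟ 2 * m) (monoCopy-size m (fromVertexColoring c₀) H mono₀)) (ind-yes (In𝔅? m H) H∈𝔅)) ⟨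
  2 * 2 ^ n * (ind (∣ S ∣ ≟ 2 * m) * ind (In𝔅? m H)) ∎
  where
  open ≤-Reasoning
  L = leftImage H f
  some-color : ∀ c → ind (IsMonoCopy? m (fromVertexColoring c) (H , S)) ≤ ∑ colors (λ a → ind (constantOn? L a c))
  some-color c with IsMonoCopy? m (fromVertexColoring c) (H , S)
  ... | no _     = z≤n
  ... | yes mono = let a , const = monoCopy⇒constantOn m c H S f inc im mono
                   in count≥1 (λ a → constantOn? L a c) (∈-colors a) const

opaque
  unfolding #on

  ∑#on : ∀ m (S : Subset n) → 2 ^ m * ∑ (vertexColorings n) (λ c → #on m (fromVertexColoring c) S) ≤
         2 * 2 ^ n * #𝔅 m * ind (∣ S ∣ ≟ 2 * m)
  ∑#on {n} m S = begin
    2 ^ m * ∑ (vertexColorings n) (λ c → #on m (fromVertexColoring c) S)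
      ≡⟨ cong (2 ^ m *_) (∑-swap (vertexColorings n) Hs mono) ⟩
    2 ^ m * ∑ Hs (λ H → ∑ (vertexColorings n) (λ c → mono c H))
      ≡⟨ ∑-*ˡ Hs (2 ^ m) (λ H → ∑ (vertexColorings n) (λ c → mono c H)) ⟨
    ∑ Hs (λ H → 2 ^ m * ∑ (vertexColorings n) (λ c → mono c H))
      ≤⟨ ∑-mono Hs (λ H → #vertexColorings-mono m H S) ⟩
    ∑ Hs (λ H → 2 * 2 ^ n * (s * ind (In𝔅? m H)))
      ≡⟨ ∑-*ˡ Hs (2 * 2 ^ n) (λ H → s * ind (In𝔅? m H)) ⟩
    2 * 2 ^ n * ∑ Hs (λ H → s * ind (In𝔅? m H))
      ≡⟨ cong (2 * 2 ^ n *_) (∑-*ˡ Hs s (λ H → ind (In𝔅? m H))) ⟩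
    2 * 2 ^ n * (s * #𝔅 m)
      ≡⟨ x∙yz≈xz∙y (2 * 2 ^ n) s (#𝔅 m) ⟩
    2 * 2 ^ n * #𝔅 m * s ∎
    where
    open ≤-Reasoning
    Hs : List (AdjacencyMatrix (2 * m))
    Hs = matrices (2 * m)
    s : ℕ
    s = ind (∣ S ∣ ≟ 2 * m)
    mono : Vec Color n → AdjacencyMatrix (2 * m) → ℕ
    mono c H = ind (IsMonoCopy? m (fromVertexColoring c) (H , S))

-- The minimum is at most the average over the 2^n vertex colorings; the common factor 2^n is
-- cancelled at the end.
M̄-upper-#𝔅 : ∀ m n → 2 ^ m * M̄ m n ≤ 2 * #𝔅 m * (n C (2 * m))
M̄-upper-#𝔅 m n = *-cancelˡ-≤ (2 ^ n) {{m^n≢0 2 n}} (begin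
  2 ^ n * (2 ^ m * M̄ m n)
    ≡⟨ x∙yz≈y∙xz (2 ^ n) (2 ^ m) (M̄ m n) ⟩
  2 ^ m * (2 ^ n * M̄ m n)
    ≡⟨ cong (2 ^ m *_) average ⟨
  2 ^ m * ∑ (vertexColorings n) (λ _ → M̄ m n)
    ≤⟨ *-monoʳ-≤ (2 ^ m) (∑-mono (vertexColorings n) (λ c →
         ≤-trans (M̄-minimal m (fromVertexColoring c)) (≤-reflexive (#monoCopies≡ m (fromVertexColoring c))))) ⟩
  2 ^ m * ∑ (vertexColorings n) (λ c → ∑ (subsets n) (#on m (fromVertexColoring c)))
    ≡⟨ cong (2 ^ m *_) (∑-swap (vertexColorings n) (subsets n) (λ c → #on m (fromVertexColoring c))) ⟩
  2 ^ m * ∑ (subsets n) (λ S → ∑ (vertexColorings n) (λ c → #on m (fromVertexColoring c) S))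
    ≡⟨ ∑-*ˡ (subsets n) (2 ^ m) (λ S → ∑ (vertexColorings n) (λ c → #on m (fromVertexColoring c) S)) ⟨
  ∑ (subsets n) (λ S → 2 ^ m * ∑ (vertexColorings n) (λ c → #on m (fromVertexColoring c) S))
    ≤⟨ ∑-mono (subsets n) (∑#on m) ⟩
  ∑ (subsets n) (λ S → 2 * 2 ^ n * #𝔅 m * ind (∣ S ∣ ≟ 2 * m))
    ≡⟨ ∑-*ˡ (subsets n) (2 * 2 ^ n * #𝔅 m) (λ S → ind (∣ S ∣ ≟ 2 * m)) ⟩
  2 * 2 ^ n * #𝔅 m * count (λ S → ∣ S ∣ ≟ 2 * m) (subsets n)
    ≡⟨ cong (2 * 2 ^ n * #𝔅 m *_) (#subsets-ofSize n (2 * m)) ⟩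
  2 * 2 ^ n * #𝔅 m * (n C (2 * m))
    ≡⟨ regroup 2 (2 ^ n) (#𝔅 m) (n C (2 * m)) ⟩
  2 ^ n * (2 * #𝔅 m * (n C (2 * m))) ∎)
  where
  open ≤-Reasoning
  regroup : ∀ a b c d → a * b * c * d ≡ b * (a * c * d)
  regroup = solve-∀
  average : ∑ (vertexColorings n) (λ _ → M̄ m n) ≡ 2 ^ n * M̄ m n
  average = trans (∑-const (vertexColorings n) (M̄ m n)) (cong (_* M̄ m n) (length-allVecs colors n))

M̄-upper : ∀ m n → 1 ≤ m → M̄ m n * (2 ^ (2 * m ∸ 2) * ((m ∸ 1) !)) ≤ (n C (2 * m)) * ((2 * m ∸ 2) !)
M̄-upper (suc p) n _ = subst (λ e → M̄ (suc p) n * (2 ^ e * p !) ≤ N * (e !)) (sym e≡2p) (*-cancelˡ-≤ 2 (begin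
  -- Here m = p + 1. One factor 2^p, together with the extra 2, is the 2^m of `M̄-upper-#𝔅`; the
  -- other is the one in (2p)!/(2^p p!).
  2 * (M * (2 ^ (2 * p) * p !))
    ≡⟨ cong (λ x → 2 * (M * (x * p !))) (trans (cong (2 ^_) (cong (p +_) (+-identityʳ p))) (^-distribˡ-+-* 2 p p)) ⟩
  2 * (M * (2 ^ p * 2 ^ p * p !))
    ≡⟨ regroup₁ 2 M (2 ^ p) (p !) ⟩
  2 * 2 ^ p * M * (2 ^ p * p !)
    ≤⟨ *-monoˡ-≤ (2 ^ p * p !) (M̄-upper-#𝔅 (suc p) n) ⟩
  2 * #𝔅 (suc p) * N * (2 ^ p * p !)
    ≤⟨ *-monoˡ-≤ (2 ^ p * p !) (*-monoˡ-≤ N (*-monoʳ-≤ 2 (#𝔅≤#matchings p))) ⟩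
  2 * #matchings (2 * p) * N * (2 ^ p * p !)
    ≡⟨ regroup₂ 2 (#matchings (2 * p)) N (2 ^ p * p !) ⟩
  2 * (N * (#matchings (2 * p) * (2 ^ p * p !)))
    ≤⟨ *-monoʳ-≤ 2 (*-monoʳ-≤ N (#matchings-bound p)) ⟩
  2 * (N * (2 * p) !) ∎))
  where
  open ≤-Reasoning
  M = M̄ (suc p) n
  N = n C (2 * suc p)
  e≡2p : 2 * suc p ∸ 2 ≡ 2 * p
  e≡2p = cong (_∸ 2) (2*suc p)
  regroup₁ : ∀ a b c d → a * (b * (c * c * d)) ≡ a * c * b * (c * d)
  regroup₁ = solve-∀
  regroup₂ : ∀ a b c d → a * b * c * d ≡ a * (c * (b * d))
  regroup₂ = solve-∀

-- Quotients

toℚᵘ-÷ : ∀ a b → toℚᵘ (a ÷ suc b) ≃ᵘ mkℚᵘ (ℤ.+ a) b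
toℚᵘ-÷ a b = ℚ.toℚᵘ-fromℚᵘ (mkℚᵘ (ℤ.+ a) b)

-- A zero b is harmless because the quotient is then 0 by convention. This lets `density≤D` cover n
-- < 2m, where the binomial coefficient vanishes.
÷-mono-≤ : ∀ a b c d → 0 < d → a * d ≤ c * b → a ÷ b ≤ℚ c ÷ d
÷-mono-≤ a zero c (suc d) _ _ = ℚ.nonNegative⁻¹ (c ÷ suc d) {{ℚ.normalize-nonNeg c (suc d)}}
÷-mono-≤ a (suc b) c (suc d) _ ad≤cb = ℚ.toℚᵘ-cancel-≤
  (ℚᵘ.≤-respˡ-≃ (ℚᵘ.≃-sym (toℚᵘ-÷ a b)) (ℚᵘ.≤-respʳ-≃ (ℚᵘ.≃-sym (toℚᵘ-÷ c d))
    (*≤* (subst₂ ℤ._≤_ (ℤ.pos-* a (suc d)) (ℤ.pos-* c (suc b)) (ℤ.+≤+ ad≤cb)))))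

÷-cancel-≤ : ∀ a b c d → 0 < b → 0 < d → a ÷ b ≤ℚ c ÷ d → a * d ≤ c * b
÷-cancel-≤ a (suc b) c (suc d) _ _ le = ℤ.drop‿+≤+ (subst₂ ℤ._≤_ (sym (ℤ.pos-* a (suc d))) (sym (ℤ.pos-* c (suc b)))
  (ℚᵘ.drop-*≤* (ℚᵘ.≤-respˡ-≃ (toℚᵘ-÷ a b) (ℚᵘ.≤-respʳ-≃ (toℚᵘ-÷ c d) (ℚ.toℚᵘ-mono-≤ le)))))

toℚ-*-÷ : ∀ x a b → toℚ x *ℚ (a ÷ b) ≡ (x * a) ÷ b
toℚ-*-÷ x a zero    = ℚ.*-zeroʳ (toℚ x)
toℚ-*-÷ x a (suc b) = ℚ.toℚᵘ-injective (begin
  toℚᵘ (toℚ x *ℚ (a ÷ suc b))                        ≈⟨ ℚ.toℚᵘ-homo-* (toℚ x) (a ÷ suc b) ⟩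
  toℚᵘ (toℚ x) *ᵘ toℚᵘ (a ÷ suc b)     ≈⟨ ℚᵘ.*-cong (toℚᵘ-÷ x 0) (toℚᵘ-÷ a b) ⟩
  mkℚᵘ (ℤ.+ x) 0 *ᵘ mkℚᵘ (ℤ.+ a) b                                     ≈⟨ *≡* (cong₂ ℤ._*_ (sym (ℤ.pos-* x a)) (cong (λ d → ℤ.+ suc d) (sym (+-identityʳ b)))) ⟩
  mkℚᵘ (ℤ.+ (x * a)) b                                               ≈⟨ toℚᵘ-÷ (x * a) b ⟨
  toℚᵘ ((x * a) ÷ suc b)                             ∎)
  where open ℚᵘ.≃-Reasoning

÷-+-÷ : ∀ a b c d → 0 < b → 0 < d → (a ÷ b) +ℚ (c ÷ d) ≡ (a * d + c * b) ÷ (b * d)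
÷-+-÷ a (suc b) c (suc d) _ _ = ℚ.toℚᵘ-injective (begin
  toℚᵘ ((a ÷ suc b) +ℚ (c ÷ suc d))                        ≈⟨ ℚ.toℚᵘ-homo-+ (a ÷ suc b) (c ÷ suc d) ⟩
  toℚᵘ (a ÷ suc b) +ᵘ toℚᵘ (c ÷ suc d)       ≈⟨ ℚᵘ.+-cong (toℚᵘ-÷ a b) (toℚᵘ-÷ c d) ⟩
  mkℚᵘ (ℤ.+ a) b +ᵘ mkℚᵘ (ℤ.+ c) d                                           ≈⟨ *≡* (cong (ℤ._* (ℤ.+ (suc b * suc d))) numerator) ⟩
  mkℚᵘ (ℤ.+ (a * suc d + c * suc b)) (d + b * suc d)                       ≈⟨ toℚᵘ-÷ (a * suc d + c * suc b) (d + b * suc d) ⟨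
  toℚᵘ ((a * suc d + c * suc b) ÷ (suc b * suc d))         ∎)
  where
  open ℚᵘ.≃-Reasoning
  numerator : ℤ.+ a ℤ.* ℤ.+ suc d ℤ.+ ℤ.+ c ℤ.* ℤ.+ suc b ≡ ℤ.+ (a * suc d + c * suc b)
  numerator = trans (cong₂ ℤ._+_ (sym (ℤ.pos-* a (suc d))) (sym (ℤ.pos-* c (suc b)))) (sym (ℤ.pos-+ (a * suc d) (c * suc b)))

≤⇒÷≤toℚ : ∀ a b c → a ≤ c * b → a ÷ b ≤ℚ toℚ c
≤⇒÷≤toℚ a b c a≤cb = ÷-mono-≤ a b c 1 (s≤s z≤n) (≤-trans (≤-reflexive (*-identityʳ a)) a≤cb)

≤⇒toℚ≤÷ : ∀ a c d → 0 < d → a * d ≤ c → toℚ a ≤ℚ c ÷ d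
≤⇒toℚ≤÷ a c d 0<d ad≤c = ÷-mono-≤ a 1 c d 0<d (≤-trans ad≤c (≤-reflexive (sym (*-identityʳ c))))

0<÷ : ∀ a b → 0 < a → 0 < b → 0ℚ <ℚ a ÷ b
0<÷ (suc a) (suc b) _ _ = ℚ.positive⁻¹ (suc a ÷ suc b) {{ℚ.normalize-pos (suc a) (suc b)}}

archimedean : ∀ c ε → 0ℚ <ℚ ε → ∃[ N ] (∀ n → N ≤ n → c ÷ n ≤ℚ ε)
-- ε has denominator q + 1 and numerator at least 1, so c(q+1) is a sufficient threshold.
archimedean c ε@(mkℚ ℤ.+[1+ p ] q _) _ = c * suc q , λ n c*q≤n →
  subst (c ÷ n ≤ℚ_) (ℚ.fromℚᵘ-toℚᵘ ε) (÷-mono-≤ c n (suc p) (suc q) (s≤s z≤n) (≤-trans c*q≤n (m≤m+n n _)))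
archimedean c (mkℚ (ℤ.+ zero) _ _) 0<ε with ℤ.+<+ () ← ℚ.drop-*<* 0<ε
archimedean c (mkℚ ℤ.-[1+ _ ] _ _) 0<ε with () ← ℚ.drop-*<* 0<ε

≤+⇒-≤ : ∀ {x y ε} → x ≤ℚ y +ℚ ε → x -ℚ y ≤ℚ ε
≤+⇒-≤ {x} {y} {ε} le = begin
  x -ℚ y                 ≤⟨ ℚ.+-monoˡ-≤ (-ℚ y) le ⟩
  y +ℚ ε -ℚ y            ≡⟨ cong (_-ℚ y) (ℚ.+-comm y ε) ⟩
  ε +ℚ y -ℚ y            ≡⟨ ℚ.+-assoc ε y (-ℚ y) ⟩
  ε +ℚ (y -ℚ y)          ≡⟨ cong (ε +ℚ_) (ℚ.+-inverseʳ y) ⟩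
  ε +ℚ 0ℚ                ≡⟨ ℚ.+-identityʳ ε ⟩
  ε                      ∎
  where open ℚ.≤-Reasoning

∣-∣≤ : ∀ {x y ε} → x ≤ℚ y +ℚ ε → y ≤ℚ x +ℚ ε → ∣ x -ℚ y ∣ℚ ≤ℚ ε
∣-∣≤ {x} {y} {ε} x≤ y≤ with ℚ.∣p∣≡p∨∣p∣≡-p (x -ℚ y)
... | inj₁ eq = subst (_≤ℚ ε) (sym eq) (≤+⇒-≤ x≤)
... | inj₂ eq = subst (_≤ℚ ε) (sym (trans eq (⁻¹-anti-homo-// x y))) (≤+⇒-≤ y≤)

x≤x+ε : ∀ x {ε} → 0ℚ <ℚ ε → x ≤ℚ x +ℚ ε
x≤x+ε x 0<ε = subst (_≤ℚ x +ℚ _) (ℚ.+-identityʳ x) (ℚ.+-monoʳ-≤ x (ℚ.<⇒≤ 0<ε))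

-- The relation is a parameter so that the increasing densities and the decreasing corrected
-- densities share one induction.
iterate-step : ∀ {_≼_ : ℚ → ℚ → Set} → (∀ {x} → x ≼ x) → (∀ {x y z} → x ≼ y → y ≼ z → x ≼ z) →
  ∀ (f : ℕ → ℚ) R → (∀ n → R ≤ n → f n ≼ f (suc n)) → ∀ {k n} → R ≤ k → k ≤ n → f k ≼ f n
iterate-step {_≼_} rfl trn f R step {k} R≤k k≤n = go (≤⇒≤′ k≤n)
  where
  go : ∀ {n} → k ≤′ n → f k ≼ f n
  go ≤′-refl        = rfl
  go (≤′-step k≤′n) = trn (go k≤′n) (step _ (≤-trans R≤k (≤′⇒≤ k≤′n)))

-- Densities

delete-step : ∀ m n → 2 * m ≤ n → M̄ m n * (suc n C (2 * m)) ≤ M̄ m (suc n) * (n C (2 * m))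
delete-step m n 2m≤n = *-cancelˡ-≤ s (+-cancelʳ-≤ (x * (2m * b′)) _ _ (begin
  s * (x * b′) + x * (2m * b′)               ≡⟨ regroup₁ s x b′ 2m ⟩
  x * ((s + 2m) * b′)                        ≡⟨ cong (λ N → x * (N * b′)) s+2m≡N ⟩
  x * (N * b′)                              ≡⟨ cong (x *_) ([n+1]*nCk+k*[n+1]Ck≡[n+1]*[n+1]Ck n 2m) ⟨
  x * (N * b + 2m * b′)                      ≡⟨ regroup₂ x N b (2m * b′) ⟩
  N * x * b + x * (2m * b′)                  ≤⟨ +-monoˡ-≤ (x * (2m * b′)) (*-monoˡ-≤ b Nx≤sy) ⟩
  s * y * b + x * (2m * b′)                  ≡⟨ cong (_+ x * (2m * b′)) (*-assoc s y b) ⟩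
  s * (y * b) + x * (2m * b′)                ∎))
  where
  open ≤-Reasoning
  2m = 2 * m
  N = suc n
  -- This is n + 1 - 2m in a form that is visibly positive, as cancelling it requires.
  s = suc (n ∸ 2m)
  x = M̄ m n
  y = M̄ m (suc n)
  b = n C 2m
  b′ = suc n C 2m
  s+2m≡N : s + 2m ≡ N
  s+2m≡N = cong suc (m∸n+n≡m 2m≤n)
  Nx≤sy : N * x ≤ s * y
  Nx≤sy = +-cancelʳ-≤ (2m * y) _ _ (≤-trans (M̄-delete m n) (≤-reflexive (trans (cong (_* y) (sym s+2m≡N)) (*-distribʳ-+ y s 2m))))
  regroup₁ : ∀ s x b k → s * (x * b) + x * (k * b) ≡ x * ((s + k) * b)
  regroup₁ = solve-∀
  regroup₂ : ∀ x n b c → x * (n * b + c) ≡ n * x * b + x * c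
  regroup₂ = solve-∀

-- M̄-clone in the form: density(n) + c/n is nonincreasing, with denominators cleared.
clone-arithmetic : ∀ {p k s j} x y K c₀ b b′ → s + j ≡ p → suc j ≡ k → let c = K * (j * k) in
  p * y ≤ (p + k) * x + K * (j * c₀) → k * b′ ≡ suc p * c₀ → s * b′ ≡ suc p * b →
  (y * suc p + c * b′) * (b * p) ≤ (x * p + c * b) * (b′ * suc p)
clone-arithmetic {s = s} {j} x y K c₀ b b′ refl refl clone absorb shift = begin
  (y * N + c * b′) * (b * p)
    ≡⟨ regroup₁ y N c b′ b p ⟩
  N * b * (p * y) + c * b * b′ * p
    ≤⟨ +-monoˡ-≤ (c * b * b′ * p) (*-monoʳ-≤ (N * b) clone) ⟩
  N * b * ((p + suc j) * x + K * (j * c₀)) + c * b * b′ * p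
    ≡⟨ regroup₂ N b (p + suc j) x K j c₀ (c * b * b′ * p) ⟩
  N * b * ((p + suc j) * x) + K * j * b * (N * c₀) + c * b * b′ * p
    ≡⟨ cong₂ (λ u v → u * ((p + suc j) * x) + K * j * b * v + c * b * b′ * p) shift absorb ⟨
  s * b′ * ((p + suc j) * x) + K * j * b * (suc j * b′) + c * b * b′ * p
    -- With k = j + 1 and s = p + 1 - k one has s(p+k) + jk = p(p+1), so the added term is the exact
    -- deficit of the main factor. The two terms with K combine because 1/(p+1) + 1/(p(p+1)) = 1/p.
    ≤⟨ m≤m+n _ (j * suc j * x * b′) ⟩
  s * b′ * ((p + suc j) * x) + K * j * b * (suc j * b′) + c * b * b′ * p + j * suc j * x * b′
    ≡⟨ regroup₃ s j x K b b′ ⟩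
  (x * p + c * b) * (b′ * N) ∎
  where
  open ≤-Reasoning
  p = s + j
  N = suc p
  c = K * (j * suc j)
  regroup₁ : ∀ y n′ c b′ b n → (y * n′ + c * b′) * (b * n) ≡ n′ * b * (n * y) + c * b * b′ * n
  regroup₁ = solve-∀
  regroup₂ : ∀ n b p x k j c₀ r → n * b * (p * x + k * (j * c₀)) + r ≡ n * b * (p * x) + k * j * b * (n * c₀) + r
  regroup₂ = solve-∀
  regroup₃ : ∀ s j x k b b′ →
    s * b′ * ((s + j + suc j) * x) + k * j * b * (suc j * b′) + k * (j * suc j) * b * b′ * (s + j) + j * suc j * x * b′
    ≡ (x * (s + j) + k * (j * suc j) * b) * (b′ * suc (s + j))
  regroup₃ = solve-∀

cloneConstant : ℕ → ℕ
cloneConstant m = #𝔅 m * ((2 * m ∸ 1) * (2 * m))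

clone-step : ∀ m n → 1 ≤ m → 2 * m ≤ n → let c = cloneConstant m in
  (M̄ m (suc n) * suc n + c * (suc n C (2 * m))) * ((n C (2 * m)) * n) ≤
  (M̄ m n * n + c * (n C (2 * m))) * ((suc n C (2 * m)) * suc n)
clone-step m n 1≤m 2m≤n = clone-arithmetic (M̄ m n) (M̄ m (suc n)) (#𝔅 m) (n C j) b b′
  s+j≡n (sym 2m≡1+j) (M̄-clone m n 2m≡1+j)
  (subst (λ k → k * (suc n C k) ≡ suc n * (n C j)) (sym 2m≡1+j) ([k+1]*[n+1]C[k+1]≡[n+1]*nCk n j))
  (+-cancelʳ-≡ (2 * m * b′) (s * b′) (suc n * b) shift)
  where
  j = 2 * m ∸ 1
  2m≡1+j : 2 * m ≡ suc j
  2m≡1+j = sym (m+[n∸m]≡n (≤-trans 1≤m (m≤m+n m _)))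
  s = suc (n ∸ 2 * m)
  b = n C (2 * m)
  b′ = suc n C (2 * m)
  s+2m≡1+n : s + 2 * m ≡ suc n
  s+2m≡1+n = cong suc (m∸n+n≡m 2m≤n)
  s+j≡n : s + j ≡ n
  s+j≡n = suc-injective (trans (sym (+-suc s j)) (trans (cong (s +_) (sym 2m≡1+j)) s+2m≡1+n))
  shift : s * b′ + 2 * m * b′ ≡ suc n * b + 2 * m * b′
  shift = trans (sym (*-distribʳ-+ b′ s (2 * m))) (trans (cong (_* b′) s+2m≡1+n) (sym ([n+1]*nCk+k*[n+1]Ck≡[n+1]*[n+1]Ck n (2 * m))))

density-step : ∀ m n → 2 * m ≤ n → density m n ≤ℚ density m (suc n)
density-step m n 2m≤n = ÷-mono-≤ (M̄ m n) (n C (2 * m)) (M̄ m (suc n)) (suc n C (2 * m)) (nCk>0 (m≤n⇒m≤1+n 2m≤n)) (delete-step m n 2m≤n)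

density-monotone : ∀ m {k n} → 2 * m ≤ k → k ≤ n → density m k ≤ℚ density m n
density-monotone m = iterate-step {_≤ℚ_} ℚ.≤-refl ℚ.≤-trans (density m) (2 * m) (density-step m)

-- The chain of single steps is run on quotients, where it is plain transitivity, and its result is
-- brought back to ℕ.
M̄-monotone : ∀ m {k n} → 2 * m ≤ k → k ≤ n → M̄ m k * (n C (2 * m)) ≤ M̄ m n * (k C (2 * m))
M̄-monotone m {k} {n} 2m≤k k≤n = ÷-cancel-≤ (M̄ m k) (k C (2 * m)) (M̄ m n) (n C (2 * m))
  (nCk>0 2m≤k) (nCk>0 (≤-trans 2m≤k k≤n)) (density-monotone m 2m≤k k≤n)

-- The sum density + c/n is nonincreasing, and its nonnegative correction at the later index is
-- dropped. Combined with `density-monotone` this yields an explicit Cauchy modulus.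
density-almost-antitone : ∀ m {k n} → 1 ≤ m → 2 * m ≤ k → k ≤ n → density m n ≤ℚ density m k +ℚ (cloneConstant m ÷ k)
density-almost-antitone m {k} {n} 1≤m 2m≤k k≤n = begin
  density m n                                     ≤⟨ ÷-mono-≤ (M̄ m n) (C₂ₘ n) (num n) (C₂ₘ n * n) (0<den 2m≤n) raise ⟩
  num n ÷ (C₂ₘ n * n)                               ≤⟨ iterate-step {λ x y → y ≤ℚ x} ℚ.≤-refl (λ p q → ℚ.≤-trans q p)
                                                       (λ n → num n ÷ (C₂ₘ n * n)) (2 * m) step 2m≤k k≤n ⟩
  num k ÷ (C₂ₘ k * k)                               ≡⟨ ÷-+-÷ (M̄ m k) (C₂ₘ k) c k (nCk>0 2m≤k) (0<n 2m≤k) ⟨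
  density m k +ℚ (c ÷ k)                          ∎
  where
  open ℚ.≤-Reasoning
  c = cloneConstant m
  C₂ₘ : ℕ → ℕ
  C₂ₘ n = n C (2 * m)
  num : ℕ → ℕ
  num n = M̄ m n * n + c * C₂ₘ n
  2m≤n : 2 * m ≤ n
  2m≤n = ≤-trans 2m≤k k≤n
  0<n : ∀ {n} → 2 * m ≤ n → 0 < n
  0<n = ≤-trans (≤-trans 1≤m (m≤m+n m _))
  0<den : ∀ {n} → 2 * m ≤ n → 0 < C₂ₘ n * n
  0<den 2m≤n = *-mono-≤ (nCk>0 2m≤n) (0<n 2m≤n)
  step : ∀ n → 2 * m ≤ n → num (suc n) ÷ (C₂ₘ (suc n) * suc n) ≤ℚ num n ÷ (C₂ₘ n * n)
  step n 2m≤n = ÷-mono-≤ (num (suc n)) (C₂ₘ (suc n) * suc n) (num n) (C₂ₘ n * n) (0<den 2m≤n) (clone-step m n 1≤m 2m≤n)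
  raise : M̄ m n * (C₂ₘ n * n) ≤ num n * C₂ₘ n
  raise = ≤-trans (≤-reflexive (x∙yz≈xz∙y (M̄ m n) (C₂ₘ n) n)) (*-monoˡ-≤ (C₂ₘ n) (m≤m+n (M̄ m n * n) (c * C₂ₘ n)))

-- Consequences of the Ramsey property, and the theorem

2m≤Ramsey : ∀ m R → Arrows𝔅 m R → 2 * m ≤ R
2m≤Ramsey m R arrows =
  let χ = optimalColoring m R
      (H , S) , copy = arrows χ
  -- The copy occupies 2m of the R vertices.
  in subst (_≤ R) (monoCopy-size m χ H copy) (∣p∣≤n S)

0<#monoCopies : ∀ m (χ : Coloring n) HS → IsMonoCopy m χ HS → 0 < #monoCopies m χ
0<#monoCopies {n} m χ (H , S) copy =
  subst (1 ≤_) (sym (length-filter≡count (IsMonoCopy? m χ) (cartesianProduct (matrices (2 * m)) (subsets n))))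
    (count≥1 (IsMonoCopy? m χ) (∈-cartesianProduct⁺ (∈-allMatrices ∈-bools H) (∈-allVecs ∈-bools S)) copy)

0<M̄ : ∀ m R → Arrows𝔅 m R → 0 < M̄ m R
0<M̄ m R arrows = 0<#monoCopies m (optimalColoring m R) (proj₁ copy) (proj₂ copy)
  where
  copy : ∃[ HS ] IsMonoCopy m (optimalColoring m R) HS
  copy = arrows (optimalColoring m R)

theorem4p3 : (m : ℕ) → 1 ≤ m → (R : ℕ) → IsRamseyNumber𝔅 m R →
    let D = ((2 * m ∸ 2) !) ÷ (2 ^ (2 * m ∸ 2) * ((m ∸ 1) !)) in
    (∀ t n → R ≤ t → t ≤ n → toℚ (M̄ m t) *ℚ ((n C (2 * m)) ÷ (t C (2 * m))) ≤ℚ toℚ (M̄ m n))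
    × (∀ n → toℚ (M̄ m n) ≤ℚ toℚ (n C (2 * m)) *ℚ D)
    × (∀ 2m n → R ≤ 2m → 2m ≤ n → density m 2m ≤ℚ density m n)
    × (∃[ π ] (density m ConvergesTo π × fromℚ (density m R) ≤ℝ π × π ≤ℝ fromℚ D))
    × ((λ n → M̄ m n) isΘ (λ n → n ^ (2 * m)))
theorem4p3 m 1≤m R (arrows , _) =
  lower , upper , (λ 2m n R≤k → density-monotone m (≤-trans 2m≤R R≤k)) ,
  (π , converges ,
    (λ δ 0<δ → R , λ n R≤n → ℚ.≤-trans (density-monotone m 2m≤R R≤n) (x≤x+ε (density m n) 0<δ)) ,
    (λ δ 0<δ → 0 , λ n _ → ℚ.≤-trans (density≤D n) (x≤x+ε (num ÷ den) 0<δ))) ,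
  -- The lower constant combines M̄(R) ≥ 1 and monotonicity of the density with n^(2m) ≤ 2^(2m)
  -- (2m)! C(n,2m). The threshold R + 4m secures both n ≥ R and n ≥ 4m.
  (1 ÷ b′ , num ÷ den , R + (2m + 2m) , 0<÷ 1 b′ (s≤s z≤n) 0<b′ , 0<÷ num den (1≤n! (2m ∸ 2)) 0<den ,
    λ n N≤n → Θ-lower n N≤n , Θ-upper n)
  where
  2m = 2 * m
  num den : ℕ
  num = (2m ∸ 2) !
  den = 2 ^ (2m ∸ 2) * (m ∸ 1) !
  b′ = (R C 2m) * (2 ^ 2m * 2m !)

  2m≤R : 2m ≤ R
  2m≤R = 2m≤Ramsey m R arrows

  0<den : 0 < den
  0<den = *-mono-≤ (m^n>0 2 (2m ∸ 2)) (1≤n! (m ∸ 1))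

  0<b′ : 0 < b′
  0<b′ = *-mono-≤ (nCk>0 2m≤R) (*-mono-≤ (m^n>0 2 2m) (1≤n! 2m))

  lower : ∀ t n → R ≤ t → t ≤ n → toℚ (M̄ m t) *ℚ ((n C 2m) ÷ (t C 2m)) ≤ℚ toℚ (M̄ m n)
  lower t n R≤t t≤n = subst (_≤ℚ toℚ (M̄ m n)) (sym (toℚ-*-÷ (M̄ m t) (n C 2m) (t C 2m)))
    (≤⇒÷≤toℚ (M̄ m t * (n C 2m)) (t C 2m) (M̄ m n) (M̄-monotone m (≤-trans 2m≤R R≤t) t≤n))

  upper : ∀ n → toℚ (M̄ m n) ≤ℚ toℚ (n C 2m) *ℚ (num ÷ den)
  upper n = subst (toℚ (M̄ m n) ≤ℚ_) (sym (toℚ-*-÷ (n C 2m) num den))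
    (≤⇒toℚ≤÷ (M̄ m n) ((n C 2m) * num) den 0<den (M̄-upper m n 1≤m))

  density≤D : ∀ n → density m n ≤ℚ num ÷ den
  density≤D n = ÷-mono-≤ (M̄ m n) (n C 2m) num den 0<den (≤-trans (M̄-upper m n 1≤m) (≤-reflexive (*-comm (n C 2m) num)))

  -- Only the rate at the smaller index matters, so smallness is asked of c/i alone.
  ordered-close : ∀ {i j ε} → 0ℚ <ℚ ε → R ≤ i → i ≤ j → cloneConstant m ÷ i ≤ℚ ε →
    (density m i ≤ℚ density m j +ℚ ε) × (density m j ≤ℚ density m i +ℚ ε)
  ordered-close {i} {j} 0<ε R≤i i≤j small =
    ℚ.≤-trans (density-monotone m (≤-trans 2m≤R R≤i) i≤j) (x≤x+ε (density m j) 0<ε) ,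
    ℚ.≤-trans (density-almost-antitone m 1≤m (≤-trans 2m≤R R≤i) i≤j) (ℚ.+-monoʳ-≤ (density m i) small)

  eventually-close : ∀ {ε} N → 0ℚ <ℚ ε → (∀ n → N ≤ n → cloneConstant m ÷ n ≤ℚ ε) →
    ∀ i j → R ⊔ N ≤ i → R ⊔ N ≤ j → density m i ≤ℚ density m j +ℚ ε
  eventually-close N 0<ε small i j N≤i N≤j =
    [ (λ i≤j → proj₁ (ordered-close 0<ε (m⊔n≤o⇒m≤o R N N≤i) i≤j (small i (m⊔n≤o⇒n≤o R N N≤i))))
    , (λ j≤i → proj₂ (ordered-close 0<ε (m⊔n≤o⇒m≤o R N N≤j) j≤i (small j (m⊔n≤o⇒n≤o R N N≤j))))
    ]′ (≤-total i j)

  close : ∀ ε → 0ℚ <ℚ ε → ∃[ N ] (∀ i j → N ≤ i → N ≤ j → density m i ≤ℚ density m j +ℚ ε)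
  close ε 0<ε = R ⊔ proj₁ arch , eventually-close (proj₁ arch) 0<ε (proj₂ arch)
    where
    arch : ∃[ N ] (∀ n → N ≤ n → cloneConstant m ÷ n ≤ℚ ε)
    arch = archimedean (cloneConstant m) ε 0<ε

  π : ℝ
  π = record
    { approx = density m
    ; cauchy = λ ε 0<ε → let N , bound = close ε 0<ε in
        N , λ i j N≤i N≤j → ∣-∣≤ (bound i j N≤i N≤j) (bound j i N≤j N≤i)
    }

  converges : density m ConvergesTo π
  converges ε 0<ε = let N , bound = close ε 0<ε in N , λ n N≤n →
    (λ δ 0<δ → N , λ i N≤i → ℚ.≤-trans
      (≤+⇒-≤ (subst (density m n ≤ℚ_) (ℚ.+-comm (density m i) ε) (bound n i N≤n N≤i))) (x≤x+ε (density m i) 0<δ)) ,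
    (λ δ 0<δ → N , λ i N≤i → ℚ.≤-trans (bound i n N≤i N≤n) (x≤x+ε (density m n +ℚ ε) 0<δ))

  Θ-lower : ∀ n → R + (2m + 2m) ≤ n → (1 ÷ b′) *ℚ toℚ (n ^ 2m) ≤ℚ toℚ (M̄ m n)
  Θ-lower n N≤n = subst (_≤ℚ toℚ (M̄ m n)) (sym (trans (ℚ.*-comm (1 ÷ b′) (toℚ (n ^ 2m))) (toℚ-*-÷ (n ^ 2m) 1 b′)))
    (≤⇒÷≤toℚ (n ^ 2m * 1) b′ (M̄ m n) (begin
      n ^ 2m * 1                                 ≡⟨ *-identityʳ (n ^ 2m) ⟩
      n ^ 2m                                     ≤⟨ n^k≤2^k*k!*nCk n 2m (m+n≤o⇒n≤o R N≤n) ⟩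
      2 ^ 2m * 2m ! * (n C 2m)                   ≡⟨ cong (2 ^ 2m * 2m ! *_) (*-identityˡ (n C 2m)) ⟨
      2 ^ 2m * 2m ! * (1 * (n C 2m))             ≤⟨ *-monoʳ-≤ (2 ^ 2m * 2m !) (*-monoˡ-≤ (n C 2m) (0<M̄ m R arrows)) ⟩
      2 ^ 2m * 2m ! * (M̄ m R * (n C 2m))         ≤⟨ *-monoʳ-≤ (2 ^ 2m * 2m !) (M̄-monotone m 2m≤R (m+n≤o⇒m≤o R N≤n)) ⟩
      2 ^ 2m * 2m ! * (M̄ m n * (R C 2m))         ≡⟨ x∙yz≈y∙zx (2 ^ 2m * 2m !) (M̄ m n) (R C 2m) ⟩
      M̄ m n * b′                                 ∎))
    where open ≤-Reasoning

  Θ-upper : ∀ n → toℚ (M̄ m n) ≤ℚ (num ÷ den) *ℚ toℚ (n ^ 2m)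
  Θ-upper n = subst (toℚ (M̄ m n) ≤ℚ_) (sym (trans (ℚ.*-comm (num ÷ den) (toℚ (n ^ 2m))) (toℚ-*-÷ (n ^ 2m) num den)))
    (≤⇒toℚ≤÷ (M̄ m n) (n ^ 2m * num) den 0<den
      (≤-trans (M̄-upper m n 1≤m) (*-monoˡ-≤ num (nCk≤n^k n 2m))))
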